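{- Let $m$ be an odd squarefree positive integer with $3\mid m$. Let $f:\mathbb{Z}_m^*\rightarrow(0,1]$ be an arbitrary function with average $\alpha$. For $i=1,2$, let $\alpha_i$ be the average of $f$ over those reduced residues $r\pmod m$ with $r\equiv i\pmod 3$. Suppose that $2\alpha_1+\alpha_2>3/2$ and $2\alpha_2+\alpha_1>3/2$. Then for any $x\in\mathbb{Z}_m$, there exist $a_1,a_2,a_3\in\mathbb{Z}_m^*$ with $x=a_1+a_2+a_3$, such that $$f(a_1)+f(a_2)+f(a_3)>\tfrac{3}{2}.$$
   Context: $\mathbb{Z}_m=\mathbb{Z}/m\mathbb{Z}$ and $\mathbb{Z}_m^*$ is the set of reduced residues (units) modulo $m$. The elements $a_1,a_2,a_3$ are not required to be distinct. -}

module Defs where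

open import Data.Fin.Base using (Fin; toℕ)
open import Data.Integer.Base using (+_)
open import Data.List.Base using (List; []; _∷_; allFin; filter; foldr; length; mapMaybe)
open import Data.Maybe.Base using (Maybe; just; nothing)
open import Data.Nat.Base as ℕ using (ℕ; NonZero)
import Data.Nat.Properties as ℕ
open import Data.Nat.Coprimality using (Coprime; coprime?)
open import Data.Nat.DivMod using (_%_; _mod_)
open import Data.Nat.Divisibility using (_∣_)
open import Data.Product.Base using (_×_; _,_; proj₁; proj₂; ∃-syntax)
open import Data.Rational.Base as ℚ using (ℚ; 0ℚ; 1ℚ; ½; ∣_∣; 1/_; _/_)
import Data.Rational.Properties as ℚ
open import Data.Rational.Solver using (module +-*-Solver)
open import Relation.Binary.PropositionalEquality
  using (_≡_; refl; sym; trans; cong; subst)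
open import Relation.Nullary using (¬_; yes; no)

-- Real numbers: Cauchy sequences of rationals carrying a modulus of
-- convergence.  No quotient is taken; the order below does not distinguish
-- sequences with the same limit.

record ℝ : Set where
  constructor mkℝ
  field
    seq    : ℕ → ℚ
    cauchy : ∀ ε → 0ℚ ℚ.< ε →
             ∃[ N ] (∀ i j → N ℕ.≤ i → N ℕ.≤ j → ∣ seq i ℚ.- seq j ∣ ℚ.< ε)

open ℝ public

infix 4 _<ℝ_ _≤ℝ_

_<ℝ_ : ℝ → ℝ → Set
x <ℝ y = ∃[ ε ] 0ℚ ℚ.< ε × ∃[ N ] (∀ n → N ℕ.≤ n → seq x n ℚ.+ ε ℚ.≤ seq y n)

_≤ℝ_ : ℝ → ℝ → Set
x ≤ℝ y = ¬ (y <ℝ x)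

fromℚ : ℚ → ℝ
fromℚ q = mkℝ (λ _ → q) λ ε 0<ε →
  0 , λ _ _ _ _ → subst (ℚ._< ε) (sym (cong ∣_∣ (ℚ.+-inverseʳ q))) 0<ε

infixl 6 _+ℝ_
infixl 7 _·ℝ_

_+ℝ_ : ℝ → ℝ → ℝ
x +ℝ y = mkℝ (λ n → seq x n ℚ.+ seq y n) cauchy-+
  where
  cauchy-+ : ∀ ε → 0ℚ ℚ.< ε →
             ∃[ N ] (∀ i j → N ℕ.≤ i → N ℕ.≤ j →
               ∣ (seq x i ℚ.+ seq y i) ℚ.- (seq x j ℚ.+ seq y j) ∣ ℚ.< ε)
  cauchy-+ ε 0<ε = M ℕ.⊔ N , bound
    where
    0<½ε : 0ℚ ℚ.< ½ ℚ.* ε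
    0<½ε = subst (ℚ._< ½ ℚ.* ε) (ℚ.*-zeroʳ ½) (ℚ.*-monoʳ-<-pos ½ 0<ε)

    M N : ℕ
    M = cauchy x (½ ℚ.* ε) 0<½ε .proj₁
    N = cauchy y (½ ℚ.* ε) 0<½ε .proj₁

    regroup : ∀ a b c d → (a ℚ.+ b) ℚ.- (c ℚ.+ d) ≡ (a ℚ.- c) ℚ.+ (b ℚ.- d)
    regroup = solve 4 (λ a b c d → (a :+ b) :- (c :+ d) := (a :- c) :+ (b :- d)) refl
      where open +-*-Solver

    halves : ½ ℚ.* ε ℚ.+ ½ ℚ.* ε ≡ ε
    halves = trans (sym (ℚ.*-distribʳ-+ ε ½ ½)) (ℚ.*-identityˡ ε)

    bound : ∀ i j → M ℕ.⊔ N ℕ.≤ i → M ℕ.⊔ N ℕ.≤ j →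
            ∣ (seq x i ℚ.+ seq y i) ℚ.- (seq x j ℚ.+ seq y j) ∣ ℚ.< ε
    bound i j i≥ j≥ = begin-strict
      ∣ (seq x i ℚ.+ seq y i) ℚ.- (seq x j ℚ.+ seq y j) ∣
        ≡⟨ cong ∣_∣ (regroup (seq x i) (seq y i) (seq x j) (seq y j)) ⟩
      ∣ (seq x i ℚ.- seq x j) ℚ.+ (seq y i ℚ.- seq y j) ∣
        ≤⟨ ℚ.∣p+q∣≤∣p∣+∣q∣ (seq x i ℚ.- seq x j) (seq y i ℚ.- seq y j) ⟩
      ∣ seq x i ℚ.- seq x j ∣ ℚ.+ ∣ seq y i ℚ.- seq y j ∣
        <⟨ ℚ.+-mono-<
             (cauchy x (½ ℚ.* ε) 0<½ε .proj₂ i j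
               (ℕ.m⊔n≤o⇒m≤o M N i≥) (ℕ.m⊔n≤o⇒m≤o M N j≥))
             (cauchy y (½ ℚ.* ε) 0<½ε .proj₂ i j
               (ℕ.m⊔n≤o⇒n≤o M N i≥) (ℕ.m⊔n≤o⇒n≤o M N j≥)) ⟩
      ½ ℚ.* ε ℚ.+ ½ ℚ.* ε
        ≡⟨ halves ⟩
      ε ∎
      where open ℚ.≤-Reasoning

_·ℝ_ : ℚ → ℝ → ℝ
q ·ℝ x = mkℝ (λ n → q ℚ.* seq x n) cauchy-·
  where
  K : ℚ
  K = ∣ q ∣ ℚ.+ 1ℚ

  0<K : 0ℚ ℚ.< K
  0<K = ℚ.+-mono-≤-< (ℚ.0≤∣p∣ q) (ℚ.positive⁻¹ 1ℚ)

  instance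
    K-pos : ℚ.Positive K
    K-pos = ℚ.positive 0<K

    K-nonZero : ℚ.NonZero K
    K-nonZero = ℚ.pos⇒nonZero K

    1/K-pos : ℚ.Positive (1/ K)
    1/K-pos = ℚ.1/pos⇒pos K

  cauchy-· : ∀ ε → 0ℚ ℚ.< ε →
             ∃[ N ] (∀ i j → N ℕ.≤ i → N ℕ.≤ j →
               ∣ q ℚ.* seq x i ℚ.- q ℚ.* seq x j ∣ ℚ.< ε)
  cauchy-· ε 0<ε
    with cauchy x (1/ K ℚ.* ε)
           (subst (ℚ._< 1/ K ℚ.* ε) (ℚ.*-zeroʳ (1/ K)) (ℚ.*-monoʳ-<-pos (1/ K) 0<ε))
  ... | N , close = N , bound
    where
    factor : ∀ a b → q ℚ.* a ℚ.- q ℚ.* b ≡ q ℚ.* (a ℚ.- b)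
    factor = solve 3 (λ q a b → q :* a :- q :* b := q :* (a :- b)) refl q
      where open +-*-Solver

    cancel : K ℚ.* (1/ K ℚ.* ε) ≡ ε
    cancel = trans (sym (ℚ.*-assoc K (1/ K) ε))
             (trans (cong (ℚ._* ε) (ℚ.*-inverseʳ K)) (ℚ.*-identityˡ ε))

    ∣q∣≤K : ∣ q ∣ ℚ.≤ K
    ∣q∣≤K = subst (ℚ._≤ K) (ℚ.+-identityʳ ∣ q ∣)
              (ℚ.+-monoʳ-≤ ∣ q ∣ (ℚ.nonNegative⁻¹ 1ℚ))

    bound : ∀ i j → N ℕ.≤ i → N ℕ.≤ j →
            ∣ q ℚ.* seq x i ℚ.- q ℚ.* seq x j ∣ ℚ.< ε
    bound i j i≥ j≥ = begin-strict
      ∣ q ℚ.* seq x i ℚ.- q ℚ.* seq x j ∣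
        ≡⟨ cong ∣_∣ (factor (seq x i) (seq x j)) ⟩
      ∣ q ℚ.* (seq x i ℚ.- seq x j) ∣
        ≡⟨ ℚ.∣p*q∣≡∣p∣*∣q∣ q (seq x i ℚ.- seq x j) ⟩
      ∣ q ∣ ℚ.* ∣ seq x i ℚ.- seq x j ∣
        ≤⟨ ℚ.*-monoʳ-≤-nonNeg ∣ seq x i ℚ.- seq x j ∣
             {{ℚ.nonNegative (ℚ.0≤∣p∣ (seq x i ℚ.- seq x j))}} ∣q∣≤K ⟩
      K ℚ.* ∣ seq x i ℚ.- seq x j ∣
        <⟨ ℚ.*-monoʳ-<-pos K (close i j i≥ j≥) ⟩
      K ℚ.* (1/ K ℚ.* ε)
        ≡⟨ cancel ⟩
      ε ∎
      where open ℚ.≤-Reasoning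

-- The empty average is 0 by convention; the sets of residues averaged over
-- below are non-empty when 3 ∣ m.
average : List ℝ → ℝ
average []          = fromℚ 0ℚ
average xs@(_ ∷ _) = (+ 1 / length xs) ·ℝ foldr _+ℝ_ (fromℚ 0ℚ) xs

Squarefree : ℕ → Set
Squarefree n = ∀ d → d ℕ.* d ∣ n → d ≡ 1

-- ℤ/mℤ, represented by the least non-negative residues.
ℤₘ : ℕ → Set
ℤₘ m = Fin m

infixl 6 _+ₘ_

_+ₘ_ : ∀ {m} .{{_ : NonZero m}} → ℤₘ m → ℤₘ m → ℤₘ m
_+ₘ_ {m} a b = (toℕ a ℕ.+ toℕ b) mod m

-- The coprimality proof is irrelevant, so that a function on ℤₘ* m depends on
-- the residue only.
record ℤₘ* (m : ℕ) : Set where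
  constructor unit
  field
    residue  : ℤₘ m
    .coprime : Coprime (toℕ residue) m

open ℤₘ* public using (residue)

reducedResidue? : ∀ m → ℤₘ m → Maybe (ℤₘ* m)
reducedResidue? m a with coprime? (toℕ a) m
... | yes a⊥m = just (unit a a⊥m)
... | no  _   = nothing

reducedResidues : ∀ m → List (ℤₘ* m)
reducedResidues m = mapMaybe (reducedResidue? m) (allFin m)

-- For 3 ∣ m, the class modulo 3 of an element of ℤ/mℤ can be read off from
-- its representative.
reducedResidues≡_mod3 : ℕ → ∀ m → List (ℤₘ* m)
reducedResidues≡ i mod3 m = filter (λ a → toℕ (residue a) % 3 ℕ.≟ i) (reducedResidues m)

-- Write m = 3q.  For a prime p ≥ 5, any target y and any h₁, h₂, h₃ on the units
-- modulo p, some units with b₁ + b₂ + b₃ ≡ y have h₁(b₁) + h₂(b₂) + h₃(b₃) at least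
-- the sum of the three averages.  Applying this to one prime factor of q after the
-- other, with the functions averaged over the remaining fibres, lifts any classes
-- j₁ + j₂ + j₃ ≡ x modulo 3 to a solution modulo m whose f-sum is at least
-- α_{j₁} + α_{j₂} + α_{j₃}.  It remains to choose (j₁, j₂, j₃) with values in {1, 2}:
-- (1, 1, 2) or (2, 2, 1) for x ≢ 0, and the better of (1, 1, 1) and (2, 2, 2) for x ≡ 0.
-- Real values are compared at a single late stage of the Cauchy sequences, where all
-- of them have settled up to ε / 4.
module Submission where

open import Defs
open import Algebra.Bundles using (CommutativeRing)
open import Data.Bool.Base using (if_then_else_; true; false)
open import Data.Empty using (⊥-elim; ⊥-elim-irr)
open import Data.Fin.Base as Fin using (Fin; toℕ; fromℕ; fromℕ<; inject₁; opposite)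
import Data.Fin.Permutation as Perm
import Data.Fin.Properties as Fin
open import Data.Integer.Base as ℤ using (ℤ; +_; -[1+_]; 0ℤ; 1ℤ)
open import Data.Integer.DivMod using (_%ℕ_; _/ℕ_; a≡a%ℕn+[a/ℕn]*n; n%ℕd<d)
open import Data.Integer.Divisibility.Signed as ℤ∣
  using (divides) renaming (_∣_ to _∣ᶻ_; _∣?_ to _∣ᶻ?_)
import Data.Integer.Properties as ℤ
open import Data.Integer.Tactic.RingSolver using (solve-∀)
open import Data.List.Base
  using (List; []; _∷_; map; filter; mapMaybe; foldr; length; tabulate; allFin)
open import Data.List.Properties using (length-map)
open import Data.List.Relation.Unary.All as All using (All; []; _∷_)
open import Data.List.Relation.Unary.Any using (Any; here; there)
open import Data.Maybe.Base using (Maybe; just; nothing; maybe′)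
open import Data.Nat.Base as ℕ using (ℕ; zero; suc; NonZero)
open import Data.Nat.Coprimality using (Coprime; coprime-Bézout; coprime?)
open import Data.Nat.DivMod using (_%_; m%n<n; m≡m%n+[m/n]*n; m<n⇒m%n≡m)
open import Data.Nat.Divisibility as ℕ using (_∣_; _∣?_)
open import Data.Nat.GCD using (module Bézout)
open import Data.Nat.ListAction using (product)
open import Data.Nat.ListAction.Properties using (∈⇒∣product)
open import Data.Nat.Primality using (Prime; prime?)
open import Data.Nat.Primality.Factorisation
  using (PrimeFactorisation; factorise; factorisationHasAllPrimeFactors)
import Data.Nat.Properties as ℕ
open import Data.Product.Base using (_×_; _,_; proj₁; proj₂; ∃-syntax)
open import Data.Rational.Base as ℚ using (ℚ; 0ℚ; 1ℚ; ½; _/_)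
import Data.Rational.Properties as ℚ
open import Data.Rational.Solver using (module +-*-Solver)
open import Data.Rational.Unnormalised.Base as ℚᵘ using (mkℚᵘ; *≡*)
import Data.Rational.Unnormalised.Properties as ℚᵘ
open import Data.Sum.Base using (inj₁; inj₂)
open import Function.Base using (_∘_; _$_)
open import Relation.Binary.PropositionalEquality
open import Relation.Nullary using (¬_; Dec; yes; no; does; ¬?; _×-dec_; contradiction)
open import Relation.Nullary.Decidable using (dec-true; dec-false; from-no; from-yes)
open import Relation.Unary using (Decidable)
import Algebra.Properties.Group ℚ.+-0-group as ℚ+
import Algebra.Properties.Semiring.Sum (CommutativeRing.semiring ℚ.+-*-commutativeRing) as Sum

residueSum : ℕ → (ℤ → ℚ) → ℚ
residueSum n h = Sum.sum {n} (λ i → h (+ toℕ i))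

syntax residueSum n (λ a → t) = Σ[ a < n ] t

Σ-cong : ∀ n {g h : ℤ → ℚ} → (∀ a → g a ≡ h a) → residueSum n g ≡ residueSum n h
Σ-cong n g≗h = Sum.sum-cong-≗ {n} λ i → g≗h (+ toℕ i)

Σ-+ : ∀ n (g h : ℤ → ℚ) → Σ[ a < n ] (g a ℚ.+ h a) ≡ residueSum n g ℚ.+ residueSum n h
Σ-+ n g h = Sum.∑-distrib-+ {n} _ _

Σ-* : ∀ n c (h : ℤ → ℚ) → Σ[ a < n ] (c ℚ.* h a) ≡ c ℚ.* residueSum n h
Σ-* n c h = sym (Sum.*-distribˡ-sum {n} c _)

Σ-comm : ∀ m n (h : ℤ → ℤ → ℚ) → Σ[ a < m ] Σ[ b < n ] h a b ≡ Σ[ b < n ] Σ[ a < m ] h a b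
Σ-comm m n h = Sum.∑-comm {m} {n} λ i j → h (+ toℕ i) (+ toℕ j)

Σ-≤0 : ∀ n {h : ℤ → ℚ} → (∀ a → h a ℚ.≤ 0ℚ) → residueSum n h ℚ.≤ 0ℚ
Σ-≤0 zero    h≤0 = ℚ.≤-refl
Σ-≤0 (suc n) h≤0 = ℚ.+-mono-≤ (h≤0 0ℤ) (Σ-≤0 n (h≤0 ∘ ℤ._+_ 1ℤ))

Periodic : ℕ → (ℤ → ℚ) → Set
Periodic n h = ∀ a c → h (a ℤ.+ c ℤ.* + n) ≡ h a

Σ-shift₁ : ∀ n {h} → Periodic n h → Σ[ a < n ] h (1ℤ ℤ.+ a) ≡ residueSum n h
Σ-shift₁ n {h} period = ℚ+.∙-cancelˡ (h 0ℤ) _ _ $ begin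
  h 0ℤ ℚ.+ Σ[ a < n ] h (1ℤ ℤ.+ a)
    ≡⟨ Sum.sum-init-last {n} (λ i → h (+ toℕ i)) ⟩
  Sum.sum {n} (λ i → h (+ toℕ (inject₁ i))) ℚ.+ h (+ toℕ (fromℕ n))
    ≡⟨ cong₂ ℚ._+_ (Sum.sum-cong-≗ {n} λ i → cong (h ∘ +_) (Fin.toℕ-inject₁ i))
                   (cong (h ∘ +_) (Fin.toℕ-fromℕ n)) ⟩
  residueSum n h ℚ.+ h (+ n)
    ≡⟨ cong (λ a → residueSum n h ℚ.+ h a) (wrap (+ n)) ⟩
  residueSum n h ℚ.+ h (0ℤ ℤ.+ 1ℤ ℤ.* + n)
    ≡⟨ cong (residueSum n h ℚ.+_) (period 0ℤ 1ℤ) ⟩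
  residueSum n h ℚ.+ h 0ℤ
    ≡⟨ ℚ.+-comm (residueSum n h) (h 0ℤ) ⟩
  h 0ℤ ℚ.+ residueSum n h ∎
  where
  open ≡-Reasoning
  wrap : ∀ a → a ≡ 0ℤ ℤ.+ 1ℤ ℤ.* a
  wrap = solve-∀

Periodic-shift : ∀ {n h} c → Periodic n h → Periodic n (λ a → h (c ℤ.+ a))
Periodic-shift {n} {h} c period a e = trans (cong h (sym (ℤ.+-assoc c a (e ℤ.* + n)))) (period (c ℤ.+ a) e)

Σ-shift-ℕ : ∀ n {h} → Periodic n h → ∀ k → Σ[ a < n ] h (+ k ℤ.+ a) ≡ residueSum n h
Σ-shift-ℕ n {h} period zero    = Σ-cong n λ a → cong h (ℤ.+-identityˡ a)
Σ-shift-ℕ n {h} period (suc k) = begin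
  Σ[ a < n ] h (+ suc k ℤ.+ a)         ≡⟨ Σ-cong n (λ a → cong h (step (+ k) a)) ⟩
  Σ[ a < n ] h (+ k ℤ.+ (1ℤ ℤ.+ a))    ≡⟨ Σ-shift₁ n {λ a → h (+ k ℤ.+ a)} (Periodic-shift (+ k) period) ⟩
  Σ[ a < n ] h (+ k ℤ.+ a)             ≡⟨ Σ-shift-ℕ n period k ⟩
  residueSum n h                       ∎
  where
  open ≡-Reasoning
  step : ∀ k a → 1ℤ ℤ.+ k ℤ.+ a ≡ k ℤ.+ (1ℤ ℤ.+ a)
  step = solve-∀
Σ-shift : ∀ n {h} → Periodic n h → ∀ c → Σ[ a < n ] h (c ℤ.+ a) ≡ residueSum n h
Σ-shift n period (+ k) = Σ-shift-ℕ n period k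
Σ-shift n {h} period -[1+ k ] = begin
  Σ[ a < n ] h (-[1+ k ] ℤ.+ a)
    ≡⟨ Σ-shift-ℕ n {λ a → h (-[1+ k ] ℤ.+ a)} (Periodic-shift -[1+ k ] period) (suc k) ⟨
  Σ[ a < n ] h (-[1+ k ] ℤ.+ (+ suc k ℤ.+ a))
    ≡⟨ Σ-cong n (λ a → cong h (cancel (+ suc k) a)) ⟩
  residueSum n h ∎
  where
  open ≡-Reasoning
  cancel : ∀ k a → ℤ.- k ℤ.+ (k ℤ.+ a) ≡ a
  cancel = solve-∀

Σ-reflect : ∀ n {h} → Periodic n h → ∀ c → Σ[ a < n ] h (c ℤ.- a) ≡ residueSum n h
Σ-reflect n {h} period c = begin
  Σ[ a < n ] h (c ℤ.- a)
    ≡⟨ Sum.∑-permute (λ i → h (c ℤ.- + toℕ i)) (Perm.reverse {n}) ⟩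
  Sum.sum {n} (λ i → h (c ℤ.- + toℕ (opposite i)))
    ≡⟨ Sum.sum-cong-≗ {n} (λ i → cong h (toℕ-opposite i)) ⟩
  Σ[ a < n ] h (c ℤ.- + n ℤ.+ 1ℤ ℤ.+ a)
    ≡⟨ Σ-shift n period (c ℤ.- + n ℤ.+ 1ℤ) ⟩
  residueSum n h ∎
  where
  open ≡-Reasoning
  solved : ∀ c n i → c ℤ.- (n ℤ.- (1ℤ ℤ.+ i)) ≡ c ℤ.- n ℤ.+ 1ℤ ℤ.+ i
  solved = solve-∀
  toℕ-opposite : ∀ i → c ℤ.- + toℕ (opposite i) ≡ c ℤ.- + n ℤ.+ 1ℤ ℤ.+ + toℕ i
  toℕ-opposite i = begin
    c ℤ.- + toℕ (opposite i)           ≡⟨ cong (λ k → c ℤ.- + k) (Fin.opposite-prop i) ⟩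
    c ℤ.- + (n ℕ.∸ suc (toℕ i))        ≡⟨ cong (λ k → c ℤ.- k) (ℤ.⊖-≥ (Fin.toℕ<n i)) ⟨
    c ℤ.- (n ℤ.⊖ suc (toℕ i))          ≡⟨ cong (λ k → c ℤ.- k) (ℤ.m-n≡m⊖n n (suc (toℕ i))) ⟨
    c ℤ.- (+ n ℤ.- (1ℤ ℤ.+ + toℕ i))   ≡⟨ solved c (+ n) (+ toℕ i) ⟩
    c ℤ.- + n ℤ.+ 1ℤ ℤ.+ + toℕ i       ∎

Σ-≤-term : ∀ n .{{_ : NonZero n}} {h} → Periodic n h → (∀ a → h a ℚ.≤ 0ℚ) →
           ∀ c → residueSum n h ℚ.≤ h c
Σ-≤-term n@(suc n-1) {h} period h≤0 c = begin
  residueSum n h            ≡⟨ Σ-shift n period c ⟨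
  h (c ℤ.+ 0ℤ) ℚ.+ rest     ≤⟨ ℚ.+-monoʳ-≤ (h (c ℤ.+ 0ℤ)) rest≤0 ⟩
  h (c ℤ.+ 0ℤ) ℚ.+ 0ℚ       ≡⟨ ℚ.+-identityʳ _ ⟩
  h (c ℤ.+ 0ℤ)              ≡⟨ cong h (ℤ.+-identityʳ c) ⟩
  h c                       ∎
  where
  open ℚ.≤-Reasoning
  rest : ℚ
  rest = Σ[ a < n-1 ] h (c ℤ.+ (1ℤ ℤ.+ a))
  rest≤0 : rest ℚ.≤ 0ℚ
  rest≤0 = Σ-≤0 n-1 λ a → h≤0 (c ℤ.+ (1ℤ ℤ.+ a))

-- Sums of three nonmultiples of p

multiple nonmultiple : ℕ → ℤ → ℚ
multiple p a with + p ∣ᶻ? a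
... | yes _ = 1ℚ
... | no  _ = 0ℚ
nonmultiple p a = 1ℚ ℚ.- multiple p a

φ : ℕ → ℚ
φ p = Σ[ a < p ] nonmultiple p a

module _ {p : ℕ} where

  multiple-∣ : ∀ {a} → + p ∣ᶻ a → multiple p a ≡ 1ℚ
  multiple-∣ {a} p∣a with + p ∣ᶻ? a
  ... | yes _   = refl
  ... | no  p∤a = contradiction p∣a p∤a

  multiple-∤ : ∀ {a} → ¬ + p ∣ᶻ a → multiple p a ≡ 0ℚ
  multiple-∤ {a} p∤a with + p ∣ᶻ? a
  ... | yes p∣a = contradiction p∣a p∤a
  ... | no  _   = refl

  nonmultiple-∣ : ∀ {a} → + p ∣ᶻ a → nonmultiple p a ≡ 0ℚ
  nonmultiple-∣ p∣a = cong (λ d → 1ℚ ℚ.- d) (multiple-∣ p∣a)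

  nonmultiple-∤ : ∀ {a} → ¬ + p ∣ᶻ a → nonmultiple p a ≡ 1ℚ
  nonmultiple-∤ p∤a = cong (λ d → 1ℚ ℚ.- d) (multiple-∤ p∤a)

  ∣-remove-multiple : ∀ {a} c → + p ∣ᶻ a ℤ.+ c ℤ.* + p → + p ∣ᶻ a
  ∣-remove-multiple {a} c p∣ = ℤ∣.∣m+n∣n⇒∣m {i = + p} {m = a} p∣ (divides c refl)

  ∣-add-multiple : ∀ {a} c → + p ∣ᶻ a → + p ∣ᶻ a ℤ.+ c ℤ.* + p
  ∣-add-multiple c p∣a = ℤ∣.∣m∣n⇒∣m+n p∣a (divides c refl)

  multiple-periodic : Periodic p (multiple p)
  multiple-periodic a c with + p ∣ᶻ? a
  ... | yes p∣a = multiple-∣ (∣-add-multiple c p∣a)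
  ... | no  p∤a = multiple-∤ (p∤a ∘ ∣-remove-multiple c)

  nonmultiple-periodic : Periodic p (nonmultiple p)
  nonmultiple-periodic a c = cong (λ d → 1ℚ ℚ.- d) (multiple-periodic a c)

  Σ-multiple : .{{_ : NonZero p}} → ∀ (h : ℤ → ℚ) → Σ[ a < p ] (multiple p a ℚ.* h a) ≡ h 0ℤ
  Σ-multiple h = go p refl
    where
    open ≡-Reasoning
    go : ∀ n .{{_ : NonZero n}} → n ≡ p → Σ[ a < n ] (multiple p a ℚ.* h a) ≡ h 0ℤ
    go (suc n) n≡p = begin
      multiple p 0ℤ ℚ.* h 0ℤ ℚ.+ Sum.sum {n} (λ i → multiple p (+ suc (toℕ i)) ℚ.* h (+ suc (toℕ i)))
        ≡⟨ cong₂ ℚ._+_ (cong (ℚ._* h 0ℤ) (multiple-∣ (divides 0ℤ refl)))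
             (Sum.sum-cong-≗ {n} λ i → trans (cong (ℚ._* h (+ suc (toℕ i))) (multiple-∤ (p∤ i)))
                                              (ℚ.*-zeroˡ (h (+ suc (toℕ i))))) ⟩
      1ℚ ℚ.* h 0ℤ ℚ.+ Sum.sum {n} (λ i → 0ℚ)
        ≡⟨ cong₂ ℚ._+_ (ℚ.*-identityˡ (h 0ℤ)) (Sum.sum-replicate-zero n) ⟩
      h 0ℤ ℚ.+ 0ℚ
        ≡⟨ ℚ.+-identityʳ (h 0ℤ) ⟩
      h 0ℤ ∎
      where
      p∤ : ∀ i → ¬ + p ∣ᶻ + suc (toℕ {n} i)
      p∤ i p∣ = ℕ.<⇒≱ (ℕ.s<s (Fin.toℕ<n i)) (subst (ℕ._≤ _) (sym n≡p) (ℕ.∣⇒≤ (ℤ∣.∣⇒∣ᵤ p∣)))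

  Σ-multiple₁ : .{{_ : NonZero p}} → residueSum p (multiple p) ≡ 1ℚ
  Σ-multiple₁ = trans (Σ-cong p (λ a → sym (ℚ.*-identityʳ (multiple p a)))) (Σ-multiple (λ _ → 1ℚ))

-1ℚ : ℚ
-1ℚ = ℚ.- 1ℚ

2ℚ 3ℚ : ℚ
2ℚ = 1ℚ ℚ.+ 1ℚ
3ℚ = 1ℚ ℚ.+ 2ℚ

∣-neg⁻¹ : ∀ {p a} → p ∣ᶻ ℤ.- a → p ∣ᶻ a
∣-neg⁻¹ {p} {a} p∣-a = subst (p ∣ᶻ_) (ℤ.neg-involutive a) (ℤ∣.∣m⇒∣-m p∣-a)

module _ (p : ℕ) .{{_ : NonZero p}} where

  private
    δ u : ℤ → ℚ
    δ = multiple p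
    u = nonmultiple p

    P : ℚ
    P = Σ[ a < p ] 1ℚ

  φ-count : φ p ≡ P ℚ.- 1ℚ
  φ-count = begin
    φ p                                     ≡⟨ Σ-cong p (λ a → lem (δ a)) ⟩
    Σ[ a < p ] (1ℚ ℚ.+ -1ℚ ℚ.* δ a)         ≡⟨ Σ-+ p (λ _ → 1ℚ) (λ a → -1ℚ ℚ.* δ a) ⟩
    P ℚ.+ Σ[ a < p ] (-1ℚ ℚ.* δ a)          ≡⟨ cong (P ℚ.+_) (Σ-* p -1ℚ δ) ⟩
    P ℚ.+ -1ℚ ℚ.* residueSum p δ            ≡⟨ cong (λ d → P ℚ.+ -1ℚ ℚ.* d) (Σ-multiple₁ {p}) ⟩
    P ℚ.+ -1ℚ ℚ.* 1ℚ                        ≡⟨⟩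
    P ℚ.- 1ℚ                                ∎
    where
    open ≡-Reasoning
    lem : ∀ d → 1ℚ ℚ.- d ≡ 1ℚ ℚ.+ -1ℚ ℚ.* d
    lem = solve 1 (λ d → con 1ℚ :- d := con 1ℚ :+ con -1ℚ :* d) refl
      where open +-*-Solver

  Σ-nonmultiple-pairs : ∀ s → Σ[ b < p ] (u b ℚ.* u (s ℤ.- b)) ≡ (P ℚ.- 2ℚ) ℚ.+ δ s
  Σ-nonmultiple-pairs s = begin
    Σ[ b < p ] (u b ℚ.* u (s ℤ.- b))
      ≡⟨ Σ-cong p (λ b → expand (δ b) (δ (s ℤ.- b))) ⟩
    Σ[ b < p ] (u b ℚ.+ (-1ℚ ℚ.* δ (s ℤ.- b) ℚ.+ δ b ℚ.* δ (s ℤ.- b)))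
      ≡⟨ Σ-+ p u (λ b → -1ℚ ℚ.* δ (s ℤ.- b) ℚ.+ δ b ℚ.* δ (s ℤ.- b)) ⟩
    φ p ℚ.+ Σ[ b < p ] (-1ℚ ℚ.* δ (s ℤ.- b) ℚ.+ δ b ℚ.* δ (s ℤ.- b))
      ≡⟨ cong₂ ℚ._+_ φ-count (Σ-+ p (λ b → -1ℚ ℚ.* δ (s ℤ.- b)) (λ b → δ b ℚ.* δ (s ℤ.- b))) ⟩
    P ℚ.- 1ℚ ℚ.+ (Σ[ b < p ] (-1ℚ ℚ.* δ (s ℤ.- b)) ℚ.+ Σ[ b < p ] (δ b ℚ.* δ (s ℤ.- b)))
      ≡⟨ cong (P ℚ.- 1ℚ ℚ.+_) (cong₂ ℚ._+_ reflected (Σ-multiple (λ b → δ (s ℤ.- b)))) ⟩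
    P ℚ.- 1ℚ ℚ.+ (-1ℚ ℚ.+ δ (s ℤ.- 0ℤ))
      ≡⟨ cong (λ a → P ℚ.- 1ℚ ℚ.+ (-1ℚ ℚ.+ δ a)) (ℤ.+-identityʳ s) ⟩
    P ℚ.- 1ℚ ℚ.+ (-1ℚ ℚ.+ δ s)
      ≡⟨ collect P (δ s) ⟩
    (P ℚ.- 2ℚ) ℚ.+ δ s ∎
    where
    open ≡-Reasoning
    expand : ∀ d e → (1ℚ ℚ.- d) ℚ.* (1ℚ ℚ.- e) ≡ (1ℚ ℚ.- d) ℚ.+ (-1ℚ ℚ.* e ℚ.+ d ℚ.* e)
    expand = solve 2 (λ d e → (con 1ℚ :- d) :* (con 1ℚ :- e) :=
                              (con 1ℚ :- d) :+ (con -1ℚ :* e :+ d :* e)) refl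
      where open +-*-Solver
    collect : ∀ P d → P ℚ.- 1ℚ ℚ.+ (-1ℚ ℚ.+ d) ≡ (P ℚ.- 2ℚ) ℚ.+ d
    collect = solve 2 (λ P d → P :- con 1ℚ :+ (con -1ℚ :+ d) := (P :- con 2ℚ) :+ d) refl
      where open +-*-Solver
    reflected : Σ[ b < p ] (-1ℚ ℚ.* δ (s ℤ.- b)) ≡ -1ℚ
    reflected = begin
      Σ[ b < p ] (-1ℚ ℚ.* δ (s ℤ.- b))   ≡⟨ Σ-* p -1ℚ (λ b → δ (s ℤ.- b)) ⟩
      -1ℚ ℚ.* Σ[ b < p ] δ (s ℤ.- b)     ≡⟨ cong (-1ℚ ℚ.*_) (Σ-reflect p (multiple-periodic {p}) s) ⟩
      -1ℚ ℚ.* residueSum p δ             ≡⟨ cong (-1ℚ ℚ.*_) (Σ-multiple₁ {p}) ⟩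
      -1ℚ ℚ.* 1ℚ                         ≡⟨⟩
      -1ℚ                                ∎

  3<φ : 5 ℕ.≤ p → 3ℚ ℚ.< φ p
  3<φ 5≤p = ℚ.<-≤-trans 3<4 (ℚ.≤-trans (go p 5≤p) (ℚ.≤-reflexive (sym φ-count)))
    where
    3<4 : 3ℚ ℚ.< 2ℚ ℚ.+ 2ℚ
    3<4 = ℚ.+-mono-<-≤ {1ℚ} {2ℚ} {2ℚ} {2ℚ} (ℚ.+-mono-<-≤ {0ℚ} {1ℚ} {1ℚ} {1ℚ} (ℚ.positive⁻¹ 1ℚ) ℚ.≤-refl) ℚ.≤-refl
    0≤Σ1 : ∀ n → 0ℚ ℚ.≤ Σ[ a < n ] 1ℚ
    0≤Σ1 zero    = ℚ.≤-refl
    0≤Σ1 (suc n) = ℚ.+-mono-≤ {0ℚ} {1ℚ} (ℚ.nonNegative⁻¹ 1ℚ) (0≤Σ1 n)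
    go : ∀ n → 5 ℕ.≤ n → 2ℚ ℚ.+ 2ℚ ℚ.≤ Σ[ a < n ] 1ℚ ℚ.- 1ℚ
    go _ (ℕ.s≤s (ℕ.s≤s (ℕ.s≤s (ℕ.s≤s (ℕ.s≤s {n = n} _))))) = begin
      2ℚ ℚ.+ 2ℚ                    ≡⟨ ℚ.+-identityʳ _ ⟨
      2ℚ ℚ.+ 2ℚ ℚ.+ 0ℚ             ≤⟨ ℚ.+-monoʳ-≤ (2ℚ ℚ.+ 2ℚ) (0≤Σ1 n) ⟩
      2ℚ ℚ.+ 2ℚ ℚ.+ Σ[ a < n ] 1ℚ  ≡⟨ lem (Σ[ a < n ] 1ℚ) ⟩
      (1ℚ ℚ.+ (1ℚ ℚ.+ (1ℚ ℚ.+ (1ℚ ℚ.+ (1ℚ ℚ.+ Σ[ a < n ] 1ℚ))))) ℚ.- 1ℚ ∎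
      where
      open ℚ.≤-Reasoning
      lem : ∀ s → 2ℚ ℚ.+ 2ℚ ℚ.+ s ≡ (1ℚ ℚ.+ (1ℚ ℚ.+ (1ℚ ℚ.+ (1ℚ ℚ.+ (1ℚ ℚ.+ s))))) ℚ.- 1ℚ
      lem = solve 1 (λ s → con 2ℚ :+ con 2ℚ :+ s :=
        (con 1ℚ :+ (con 1ℚ :+ (con 1ℚ :+ (con 1ℚ :+ (con 1ℚ :+ s))))) :- con 1ℚ) refl
        where open +-*-Solver

  0<φ : 5 ℕ.≤ p → 0ℚ ℚ.< φ p
  0<φ 5≤p = ℚ.<-trans (ℚ.positive⁻¹ 3ℚ) (3<φ 5≤p)

  -- Suppose kᵢ vanish on multiples of p, have sum zero, and that F = k₁ + k₂ + k₃ is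
  -- negative at all triples of nonmultiples with sum y.  The sum T of F over these triples
  -- modulo p is k₁(y) + k₂(y) + k₃(y); its part with first entry y is (p − 1) k₁(y), so
  -- T ≤ (p − 1) k₁(y).  Adding the three such bounds gives 3 T ≤ (p − 1) T, which is
  -- impossible since T < 0 and p ≥ 5.
  module ZeroSum (y : ℤ) where

    third : ℤ → ℤ → ℤ
    third a b = y ℤ.- a ℤ.- b

    valid : ℤ → ℤ → ℚ
    valid a b = u a ℚ.* (u b ℚ.* u (third a b))

    record Balanced (k : ℤ → ℚ) : Set where
      field
        periodic : Periodic p k
        vanish   : ∀ {a} → + p ∣ᶻ a → k a ≡ 0ℚ
        zero-sum : residueSum p k ≡ 0ℚ

    open Balanced

    u-* : ∀ {k} → Balanced k → ∀ a → u a ℚ.* k a ≡ k a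
    u-* {k} bal a with + p ∣ᶻ? a
    ... | yes p∣a = trans (ℚ.*-zeroˡ (k a)) (sym (vanish bal p∣a))
    ... | no  p∤a = ℚ.*-identityˡ (k a)

    third-swap : ∀ a b → third a b ≡ third b a
    third-swap a b = lem y a b
      where
      lem : ∀ y a b → y ℤ.- a ℤ.- b ≡ y ℤ.- b ℤ.- a
      lem = solve-∀

    third-third : ∀ a b → third a (third a b) ≡ b
    third-third a b = lem y a b
      where
      lem : ∀ y a b → y ℤ.- a ℤ.- (y ℤ.- a ℤ.- b) ≡ b
      lem = solve-∀

    Σ-first : ∀ {k} → Balanced k → Σ[ a < p ] Σ[ b < p ] (valid a b ℚ.* k a) ≡ k y
    Σ-first {k} bal = begin
      Σ[ a < p ] Σ[ b < p ] (valid a b ℚ.* k a)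
        ≡⟨ Σ-cong p (λ a → trans (Σ-cong p λ b → regroup (u a) (u b ℚ.* u (third a b)) (k a))
                                (Σ-* p (u a ℚ.* k a) λ b → u b ℚ.* u (third a b))) ⟩
      Σ[ a < p ] (u a ℚ.* k a ℚ.* Σ[ b < p ] (u b ℚ.* u (third a b)))
        ≡⟨ Σ-cong p (λ a → cong₂ ℚ._*_ (u-* bal a) (Σ-nonmultiple-pairs (y ℤ.- a))) ⟩
      Σ[ a < p ] (k a ℚ.* ((P ℚ.- 2ℚ) ℚ.+ δ (y ℤ.- a)))
        ≡⟨ Σ-cong p (λ a → expand (k a) (P ℚ.- 2ℚ) (δ (y ℤ.- a))) ⟩
      Σ[ a < p ] ((P ℚ.- 2ℚ) ℚ.* k a ℚ.+ δ (y ℤ.- a) ℚ.* k a)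
        ≡⟨ Σ-+ p (λ a → (P ℚ.- 2ℚ) ℚ.* k a) (λ a → δ (y ℤ.- a) ℚ.* k a) ⟩
      Σ[ a < p ] ((P ℚ.- 2ℚ) ℚ.* k a) ℚ.+ Σ[ a < p ] (δ (y ℤ.- a) ℚ.* k a)
        ≡⟨ cong₂ ℚ._+_ (trans (Σ-* p (P ℚ.- 2ℚ) k) (trans (cong ((P ℚ.- 2ℚ) ℚ.*_) (zero-sum bal)) (ℚ.*-zeroʳ (P ℚ.- 2ℚ))))
                       at-y ⟩
      0ℚ ℚ.+ k y
        ≡⟨ ℚ.+-identityˡ (k y) ⟩
      k y ∎
      where
      open ≡-Reasoning
      regroup : ∀ x v k → x ℚ.* v ℚ.* k ≡ x ℚ.* k ℚ.* v
      regroup = solve 3 (λ x v k → x :* v :* k := x :* k :* v) refl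
        where open +-*-Solver
      expand : ∀ k q d → k ℚ.* (q ℚ.+ d) ≡ q ℚ.* k ℚ.+ d ℚ.* k
      expand = solve 3 (λ k q d → k :* (q :+ d) := q :* k :+ d :* k) refl
        where open +-*-Solver
      back : ∀ y a → y ℤ.- (y ℤ.- a) ≡ a
      back = solve-∀
      at-y : Σ[ a < p ] (δ (y ℤ.- a) ℚ.* k a) ≡ k y
      at-y = begin
        Σ[ a < p ] (δ (y ℤ.- a) ℚ.* k a)
          ≡⟨ Σ-cong p (λ a → cong (λ c → δ (y ℤ.- a) ℚ.* k c) (sym (back y a))) ⟩
        Σ[ a < p ] (δ (y ℤ.- a) ℚ.* k (y ℤ.- (y ℤ.- a)))
          ≡⟨ Σ-reflect p {λ a → δ a ℚ.* k (y ℤ.- a)} per y ⟩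
        Σ[ a < p ] (δ a ℚ.* k (y ℤ.- a))
          ≡⟨ Σ-multiple (λ a → k (y ℤ.- a)) ⟩
        k (y ℤ.- 0ℤ)
          ≡⟨ cong k (ℤ.+-identityʳ y) ⟩
        k y ∎
        where
        per : Periodic p (λ a → δ a ℚ.* k (y ℤ.- a))
        per a c = cong₂ ℚ._*_ (multiple-periodic {p} a c)
                    (trans (cong k (lem y a c (+ p))) (periodic bal (y ℤ.- a) (ℤ.- c)))
          where
          lem : ∀ y a c n → y ℤ.- (a ℤ.+ c ℤ.* n) ≡ y ℤ.- a ℤ.+ ℤ.- c ℤ.* n
          lem = solve-∀

    valid-swap : ∀ a b → valid a b ≡ valid b a
    valid-swap a b = trans (lem (u a) (u b) (u (third a b)))
                           (cong (λ c → u b ℚ.* (u a ℚ.* u c)) (third-swap a b))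
      where
      lem : ∀ x y z → x ℚ.* (y ℚ.* z) ≡ y ℚ.* (x ℚ.* z)
      lem = solve 3 (λ x y z → x :* (y :* z) := y :* (x :* z)) refl
        where open +-*-Solver

    third-periodic : ∀ {k} → Periodic p k → ∀ a → Periodic p (λ b → k (third a b))
    third-periodic {k} per a b c = trans (cong k (lem y a b c (+ p))) (per (third a b) (ℤ.- c))
      where
      lem : ∀ y a b c n → y ℤ.- a ℤ.- (b ℤ.+ c ℤ.* n) ≡ y ℤ.- a ℤ.- b ℤ.+ ℤ.- c ℤ.* n
      lem = solve-∀

    valid-periodic : ∀ a → Periodic p (valid a)
    valid-periodic a b c =
      cong₂ (λ v w → u a ℚ.* (v ℚ.* w)) (nonmultiple-periodic {p} b c)
            (third-periodic (nonmultiple-periodic {p}) a b c)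

    Σ-second : ∀ {k} → Balanced k → Σ[ a < p ] Σ[ b < p ] (valid a b ℚ.* k b) ≡ k y
    Σ-second {k} bal = begin
      Σ[ a < p ] Σ[ b < p ] (valid a b ℚ.* k b)
        ≡⟨ Σ-comm p p (λ a b → valid a b ℚ.* k b) ⟩
      Σ[ b < p ] Σ[ a < p ] (valid a b ℚ.* k b)
        ≡⟨ Σ-cong p (λ b → Σ-cong p λ a → cong (ℚ._* k b) (valid-swap a b)) ⟩
      Σ[ b < p ] Σ[ a < p ] (valid b a ℚ.* k b)
        ≡⟨ Σ-first bal ⟩
      k y ∎
      where open ≡-Reasoning

    Σ-third : ∀ {k} → Balanced k → Σ[ a < p ] Σ[ b < p ] (valid a b ℚ.* k (third a b)) ≡ k y
    Σ-third {k} bal = begin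
      Σ[ a < p ] Σ[ b < p ] (valid a b ℚ.* k (third a b))
        ≡⟨ Σ-cong p (λ a → Σ-cong p λ b → cong (ℚ._* k (third a b)) (valid-third a b)) ⟩
      Σ[ a < p ] Σ[ b < p ] (valid a (third a b) ℚ.* k (third a b))
        ≡⟨ Σ-cong p (λ a → Σ-reflect p {λ b → valid a b ℚ.* k b}
             (λ b c → cong₂ ℚ._*_ (valid-periodic a b c) (periodic bal b c)) (y ℤ.- a)) ⟩
      Σ[ a < p ] Σ[ b < p ] (valid a b ℚ.* k b)
        ≡⟨ Σ-second bal ⟩
      k y ∎
      where
      open ≡-Reasoning
      valid-third : ∀ a b → valid a b ≡ valid a (third a b)
      valid-third a b = cong (u a ℚ.*_) (trans (ℚ.*-comm (u b) (u (third a b)))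
        (cong (λ c → u (third a b) ℚ.* u c) (sym (third-third a b))))

    third-sum : ∀ a b → a ℤ.+ b ℤ.+ third a b ≡ y
    third-sum = lem y
      where
      lem : ∀ y a b → a ℤ.+ b ℤ.+ (y ℤ.- a ℤ.- b) ≡ y
      lem = solve-∀

    Nonpositive : (k₁ k₂ k₃ : ℤ → ℚ) → Set
    Nonpositive k₁ k₂ k₃ = ∀ {a b c} → ¬ + p ∣ᶻ a → ¬ + p ∣ᶻ b → ¬ + p ∣ᶻ c → a ℤ.+ b ℤ.+ c ≡ y →
      k₁ a ℚ.+ k₂ b ℚ.+ k₃ c ℚ.≤ 0ℚ

    module _ {k₁ k₂ k₃} (bal₁ : Balanced k₁) (bal₂ : Balanced k₂) (bal₃ : Balanced k₃)
             (nonpos : Nonpositive k₁ k₂ k₃) where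

      term : ℤ → ℤ → ℚ
      term a b = valid a b ℚ.* (k₁ a ℚ.+ k₂ b ℚ.+ k₃ (third a b))

      term-zero : ∀ {a b} → valid a b ≡ 0ℚ → term a b ≡ 0ℚ
      term-zero {a} {b} invalid =
        trans (cong (ℚ._* F) invalid) (ℚ.*-zeroˡ F)
        where
        F : ℚ
        F = k₁ a ℚ.+ k₂ b ℚ.+ k₃ (third a b)

      term-valid : ∀ {a b} → ¬ + p ∣ᶻ a → ¬ + p ∣ᶻ b → ¬ + p ∣ᶻ third a b →
                   term a b ≡ k₁ a ℚ.+ k₂ b ℚ.+ k₃ (third a b)
      term-valid {a} {b} p∤a p∤b p∤c =
        trans (cong (ℚ._* F) (cong₂ ℚ._*_ (nonmultiple-∤ p∤a) (cong₂ ℚ._*_ (nonmultiple-∤ p∤b) (nonmultiple-∤ p∤c))))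
              (ℚ.*-identityˡ F)
        where
        F : ℚ
        F = k₁ a ℚ.+ k₂ b ℚ.+ k₃ (third a b)

      term≤0 : ∀ a b → term a b ℚ.≤ 0ℚ
      term≤0 a b = cases (+ p ∣ᶻ? a) (+ p ∣ᶻ? b) (+ p ∣ᶻ? third a b)
        where
        cases : Dec (+ p ∣ᶻ a) → Dec (+ p ∣ᶻ b) → Dec (+ p ∣ᶻ third a b) → term a b ℚ.≤ 0ℚ
        cases (yes p∣a) _ _ = ℚ.≤-reflexive
          (term-zero (trans (cong (ℚ._* (u b ℚ.* u (third a b))) (nonmultiple-∣ p∣a)) (ℚ.*-zeroˡ (u b ℚ.* u (third a b)))))
        cases (no _) (yes p∣b) _ = ℚ.≤-reflexive
          (term-zero (trans (cong (λ v → u a ℚ.* (v ℚ.* u (third a b))) (nonmultiple-∣ p∣b))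
            (trans (cong (u a ℚ.*_) (ℚ.*-zeroˡ (u (third a b)))) (ℚ.*-zeroʳ (u a)))))
        cases (no _) (no _) (yes p∣c) = ℚ.≤-reflexive
          (term-zero (trans (cong (λ v → u a ℚ.* (u b ℚ.* v)) (nonmultiple-∣ p∣c))
            (trans (cong (u a ℚ.*_) (ℚ.*-zeroʳ (u b))) (ℚ.*-zeroʳ (u a)))))
        cases (no p∤a) (no p∤b) (no p∤c) =
          ℚ.≤-trans (ℚ.≤-reflexive (term-valid p∤a p∤b p∤c)) (nonpos p∤a p∤b p∤c (third-sum a b))

      term-periodicʳ : ∀ a → Periodic p (term a)
      term-periodicʳ a b c = cong₂ ℚ._*_ (valid-periodic a b c)
        (cong₂ (λ x z → k₁ a ℚ.+ x ℚ.+ z) (periodic bal₂ b c) (third-periodic (periodic bal₃) a b c))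

      term-periodicˡ : ∀ b → Periodic p (λ a → term a b)
      term-periodicˡ b a c = cong₂ ℚ._*_
        (trans (valid-swap (a ℤ.+ c ℤ.* + p) b) (trans (valid-periodic b a c) (valid-swap b a)))
        (cong₂ (λ x z → x ℚ.+ k₂ b ℚ.+ z) (periodic bal₁ a c)
          (trans (cong k₃ (third-swap (a ℤ.+ c ℤ.* + p) b))
          (trans (third-periodic (periodic bal₃) b a c) (cong k₃ (third-swap b a)))))

      Σ-term : Σ[ a < p ] Σ[ b < p ] term a b ≡ k₁ y ℚ.+ k₂ y ℚ.+ k₃ y
      Σ-term = begin
        Σ[ a < p ] Σ[ b < p ] term a b
          ≡⟨ Σ-cong p (λ a → trans (Σ-cong p λ b → expand (valid a b) (k₁ a) (k₂ b) (k₃ (third a b)))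
              (trans (Σ-+ p (λ b → valid a b ℚ.* k₁ a ℚ.+ valid a b ℚ.* k₂ b)
                            (λ b → valid a b ℚ.* k₃ (third a b)))
                     (cong (ℚ._+ T₃ a) (Σ-+ p (λ b → valid a b ℚ.* k₁ a) (λ b → valid a b ℚ.* k₂ b))))) ⟩
        Σ[ a < p ] (T₁ a ℚ.+ T₂ a ℚ.+ T₃ a)
          ≡⟨ Σ-+ p (λ a → T₁ a ℚ.+ T₂ a) T₃ ⟩
        Σ[ a < p ] (T₁ a ℚ.+ T₂ a) ℚ.+ residueSum p T₃
          ≡⟨ cong (ℚ._+ residueSum p T₃) (Σ-+ p T₁ T₂) ⟩
        residueSum p T₁ ℚ.+ residueSum p T₂ ℚ.+ residueSum p T₃
          ≡⟨ cong₂ ℚ._+_ (cong₂ ℚ._+_ (Σ-first bal₁) (Σ-second bal₂)) (Σ-third bal₃) ⟩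
        k₁ y ℚ.+ k₂ y ℚ.+ k₃ y ∎
        where
        open ≡-Reasoning
        T₁ T₂ T₃ : ℤ → ℚ
        T₁ a = Σ[ b < p ] (valid a b ℚ.* k₁ a)
        T₂ a = Σ[ b < p ] (valid a b ℚ.* k₂ b)
        T₃ a = Σ[ b < p ] (valid a b ℚ.* k₃ (third a b))
        expand : ∀ v k l m → v ℚ.* (k ℚ.+ l ℚ.+ m) ≡ v ℚ.* k ℚ.+ v ℚ.* l ℚ.+ v ℚ.* m
        expand = solve 4 (λ v k l m → v :* (k :+ l :+ m) := v :* k :+ v :* l :+ v :* m) refl
          where open +-*-Solver

      total≤row : ∀ a → k₁ y ℚ.+ k₂ y ℚ.+ k₃ y ℚ.≤ residueSum p (term a)
      total≤row a = ℚ.≤-trans (ℚ.≤-reflexive (sym Σ-term))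
        (Σ-≤-term p {λ a → residueSum p (term a)} (λ a c → Σ-cong p λ b → term-periodicˡ b a c)
          (λ a → Σ-≤0 p (term≤0 a)) a)

      total≤term : ∀ a b → k₁ y ℚ.+ k₂ y ℚ.+ k₃ y ℚ.≤ term a b
      total≤term a b = ℚ.≤-trans (total≤row a) (Σ-≤-term p (term-periodicʳ a) (term≤0 a) b)

      row-y : ¬ + p ∣ᶻ y → residueSum p (term y) ≡ φ p ℚ.* k₁ y
      row-y p∤y = begin
        Σ[ b < p ] term y b
          ≡⟨ Σ-cong p simplify ⟩
        Σ[ b < p ] (k₁ y ℚ.* u b ℚ.+ k₂ b ℚ.+ k₃ (0ℤ ℤ.- b))
          ≡⟨ Σ-+ p (λ b → k₁ y ℚ.* u b ℚ.+ k₂ b) (λ b → k₃ (0ℤ ℤ.- b)) ⟩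
        Σ[ b < p ] (k₁ y ℚ.* u b ℚ.+ k₂ b) ℚ.+ Σ[ b < p ] k₃ (0ℤ ℤ.- b)
          ≡⟨ cong₂ ℚ._+_ (Σ-+ p (λ b → k₁ y ℚ.* u b) k₂) (Σ-reflect p (periodic bal₃) 0ℤ) ⟩
        Σ[ b < p ] (k₁ y ℚ.* u b) ℚ.+ residueSum p k₂ ℚ.+ residueSum p k₃
          ≡⟨ cong₂ ℚ._+_ (cong₂ ℚ._+_ (Σ-* p (k₁ y) u) (zero-sum bal₂)) (zero-sum bal₃) ⟩
        k₁ y ℚ.* φ p ℚ.+ 0ℚ ℚ.+ 0ℚ
          ≡⟨ trans (ℚ.+-identityʳ _) (ℚ.+-identityʳ _) ⟩
        k₁ y ℚ.* φ p
          ≡⟨ ℚ.*-comm (k₁ y) (φ p) ⟩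
        φ p ℚ.* k₁ y ∎
        where
        open ≡-Reasoning
        third-y : ∀ b → third y b ≡ 0ℤ ℤ.- b
        third-y = lem y
          where
          lem : ∀ y b → y ℤ.- y ℤ.- b ≡ 0ℤ ℤ.- b
          lem = solve-∀
        neg : ∀ b → 0ℤ ℤ.- b ≡ ℤ.- b
        neg b = ℤ.+-identityˡ (ℤ.- b)
        simplify : ∀ b → term y b ≡ k₁ y ℚ.* u b ℚ.+ k₂ b ℚ.+ k₃ (0ℤ ℤ.- b)
        simplify b = begin
          term y b
            ≡⟨ cong₂ (λ v c → v ℚ.* (u b ℚ.* u c) ℚ.* (k₁ y ℚ.+ k₂ b ℚ.+ k₃ c)) (nonmultiple-∤ p∤y) (third-y b) ⟩
          1ℚ ℚ.* (u b ℚ.* u (0ℤ ℤ.- b)) ℚ.* (k₁ y ℚ.+ k₂ b ℚ.+ k₃ (0ℤ ℤ.- b))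
            ≡⟨ cases (+ p ∣ᶻ? b) ⟩
          k₁ y ℚ.* u b ℚ.+ k₂ b ℚ.+ k₃ (0ℤ ℤ.- b) ∎
          where
          cases : Dec (+ p ∣ᶻ b) → 1ℚ ℚ.* (u b ℚ.* u (0ℤ ℤ.- b)) ℚ.* (k₁ y ℚ.+ k₂ b ℚ.+ k₃ (0ℤ ℤ.- b)) ≡
                  k₁ y ℚ.* u b ℚ.+ k₂ b ℚ.+ k₃ (0ℤ ℤ.- b)
          cases (yes p∣b)
            rewrite nonmultiple-∣ p∣b | vanish bal₂ p∣b
                  | vanish bal₃ (subst (+ p ∣ᶻ_) (sym (neg b)) (ℤ∣.∣m⇒∣-m p∣b)) = lem (u (0ℤ ℤ.- b)) (k₁ y)
            where
            lem : ∀ v k → 1ℚ ℚ.* (0ℚ ℚ.* v) ℚ.* (k ℚ.+ 0ℚ ℚ.+ 0ℚ) ≡ k ℚ.* 0ℚ ℚ.+ 0ℚ ℚ.+ 0ℚ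
            lem = solve 2 (λ v k → con 1ℚ :* (con 0ℚ :* v) :* (k :+ con 0ℚ :+ con 0ℚ) :=
                                   k :* con 0ℚ :+ con 0ℚ :+ con 0ℚ) refl
              where open +-*-Solver
          cases (no p∤b)
            rewrite nonmultiple-∤ p∤b
                  | nonmultiple-∤ {p} {0ℤ ℤ.- b} (p∤b ∘ ∣-neg⁻¹ ∘ subst (+ p ∣ᶻ_) (neg b)) =
            lem (k₁ y) (k₂ b) (k₃ (0ℤ ℤ.- b))
            where
            lem : ∀ k l m → 1ℚ ℚ.* (1ℚ ℚ.* 1ℚ) ℚ.* (k ℚ.+ l ℚ.+ m) ≡ k ℚ.* 1ℚ ℚ.+ l ℚ.+ m
            lem = solve 3 (λ k l m → con 1ℚ :* (con 1ℚ :* con 1ℚ) :* (k :+ l :+ m) :=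
                                   k :* con 1ℚ :+ l :+ m) refl
              where open +-*-Solver

      total≤φ* : k₁ y ℚ.+ k₂ y ℚ.+ k₃ y ℚ.≤ φ p ℚ.* k₁ y
      total≤φ* with + p ∣ᶻ? y
      ... | no p∤y  = ℚ.≤-trans (total≤row y) (ℚ.≤-reflexive (row-y p∤y))
      ... | yes p∣y = ℚ.≤-reflexive (trans
        (cong₂ ℚ._+_ (cong₂ ℚ._+_ (vanish bal₁ p∣y) (vanish bal₂ p∣y)) (vanish bal₃ p∣y))
        (sym (trans (cong (φ p ℚ.*_) (vanish bal₁ p∣y)) (ℚ.*-zeroʳ (φ p)))))

    Negative : (k₁ k₂ k₃ : ℤ → ℚ) → Set
    Negative k₁ k₂ k₃ = ∀ {a b c} → ¬ + p ∣ᶻ a → ¬ + p ∣ᶻ b → ¬ + p ∣ᶻ c → a ℤ.+ b ℤ.+ c ≡ y →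
      k₁ a ℚ.+ k₂ b ℚ.+ k₃ c ℚ.< 0ℚ

    negative⇒nonpositive : ∀ {k₁ k₂ k₃} → Negative k₁ k₂ k₃ → Nonpositive k₁ k₂ k₃
    negative⇒nonpositive neg p∤a p∤b p∤c eq = ℚ.<⇒≤ (neg p∤a p∤b p∤c eq)

    nonpositive-rotate : ∀ {k₁ k₂ k₃} → Nonpositive k₁ k₂ k₃ → Nonpositive k₂ k₃ k₁
    nonpositive-rotate {k₁} {k₂} {k₃} np {b} {c} {a} p∤b p∤c p∤a eq =
      ℚ.≤-trans (ℚ.≤-reflexive (rotate (k₂ b) (k₃ c) (k₁ a)))
                (np p∤a p∤b p∤c (trans (rotateℤ a b c) eq))
      where
      rotate : ∀ x z w → x ℚ.+ z ℚ.+ w ≡ w ℚ.+ x ℚ.+ z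
      rotate = solve 3 (λ x z w → x :+ z :+ w := w :+ x :+ z) refl
        where open +-*-Solver
      rotateℤ : ∀ a b c → a ℤ.+ b ℤ.+ c ≡ b ℤ.+ c ℤ.+ a
      rotateℤ = solve-∀

    module _ (5≤p : 5 ℕ.≤ p) where

      ∤-small : ∀ {j} .{{_ : NonZero j}} → j ℕ.< 5 → ¬ + p ∣ᶻ + j
      ∤-small {j} j<5 p∣j = ℕ.<⇒≱ (ℕ.<-≤-trans j<5 5≤p) (ℕ.∣⇒≤ (ℤ∣.∣⇒∣ᵤ p∣j))

      validPair : ∃[ a ] ∃[ b ] (¬ + p ∣ᶻ a × ¬ + p ∣ᶻ b × ¬ + p ∣ᶻ third a b)
      validPair with + p ∣ᶻ? third 1ℤ 1ℤ
      ... | no  p∤c = 1ℤ , 1ℤ , ∤-small (ℕ.s≤s (ℕ.s≤s ℕ.z≤n)) , ∤-small (ℕ.s≤s (ℕ.s≤s ℕ.z≤n)) , p∤c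
      ... | yes p∣c = 1ℤ , + 2 , ∤-small (ℕ.s≤s (ℕ.s≤s ℕ.z≤n)) , ∤-small (ℕ.s≤s (ℕ.s≤s (ℕ.s≤s ℕ.z≤n))) ,
        λ p∣c′ → ∤-small (ℕ.s≤s (ℕ.s≤s ℕ.z≤n)) (subst (+ p ∣ᶻ_) (lem y) (ℤ∣.∣m∣n⇒∣m-n p∣c p∣c′))
        where
        lem : ∀ y → (y ℤ.- 1ℤ ℤ.- 1ℤ) ℤ.- (y ℤ.- 1ℤ ℤ.- + 2) ≡ 1ℤ
        lem = solve-∀

    ¬negative : 5 ℕ.≤ p → ∀ {k₁ k₂ k₃} → Balanced k₁ → Balanced k₂ → Balanced k₃ →
                ¬ Negative k₁ k₂ k₃
    ¬negative 5≤p {k₁} {k₂} {k₃} bal₁ bal₂ bal₃ neg with validPair 5≤p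
    ... | a , b , p∤a , p∤b , p∤c = ℚ.<-irrefl refl (ℚ.<-≤-trans φT<3T (begin
      3ℚ ℚ.* T
        ≡⟨ triple T ⟩
      T ℚ.+ T ℚ.+ T
        ≤⟨ ℚ.+-mono-≤ (ℚ.+-mono-≤
             (total≤φ* bal₁ bal₂ bal₃ np)
             (ℚ.≤-trans (ℚ.≤-reflexive (rotate (k₁ y) (k₂ y) (k₃ y)))
               (total≤φ* bal₂ bal₃ bal₁ np′)))
             (ℚ.≤-trans (ℚ.≤-reflexive (sym (rotate (k₃ y) (k₁ y) (k₂ y))))
               (total≤φ* bal₃ bal₁ bal₂ (nonpositive-rotate {k₂} np′))) ⟩
      φ p ℚ.* k₁ y ℚ.+ φ p ℚ.* k₂ y ℚ.+ φ p ℚ.* k₃ y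
        ≡⟨ factor (φ p) (k₁ y) (k₂ y) (k₃ y) ⟨
      φ p ℚ.* T ∎))
      where
      open ℚ.≤-Reasoning
      T : ℚ
      T = k₁ y ℚ.+ k₂ y ℚ.+ k₃ y
      np : Nonpositive k₁ k₂ k₃
      np = negative⇒nonpositive {k₁} neg
      np′ : Nonpositive k₂ k₃ k₁
      np′ = nonpositive-rotate {k₁} np
      T<0 : T ℚ.< 0ℚ
      T<0 = ℚ.≤-<-trans (total≤term bal₁ bal₂ bal₃ np a b)
        (ℚ.≤-<-trans (ℚ.≤-reflexive (term-valid bal₁ bal₂ bal₃ np p∤a p∤b p∤c))
          (neg p∤a p∤b p∤c (third-sum a b)))
      φT<3T : φ p ℚ.* T ℚ.< 3ℚ ℚ.* T
      φT<3T = ℚ.*-monoˡ-<-neg T {{ℚ.negative T<0}} (3<φ 5≤p)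
      triple : ∀ t → 3ℚ ℚ.* t ≡ t ℚ.+ t ℚ.+ t
      triple = solve 1 (λ t → con 3ℚ :* t := t :+ t :+ t) refl
        where open +-*-Solver
      rotate : ∀ a b c → a ℚ.+ b ℚ.+ c ≡ b ℚ.+ c ℚ.+ a
      rotate = solve 3 (λ a b c → a :+ b :+ c := b :+ c :+ a) refl
        where open +-*-Solver
      factor : ∀ f a b c → f ℚ.* (a ℚ.+ b ℚ.+ c) ≡ f ℚ.* a ℚ.+ f ℚ.* b ℚ.+ f ℚ.* c
      factor = solve 4 (λ f a b c → f :* (a :+ b :+ c) := f :* a :+ f :* b :+ f :* c) refl
        where open +-*-Solver

    Solution : (k₁ k₂ k₃ : ℤ → ℚ) → ℤ → ℤ → Set
    Solution k₁ k₂ k₃ a b = ¬ + p ∣ᶻ a × ¬ + p ∣ᶻ b × ¬ + p ∣ᶻ third a b ×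
      0ℚ ℚ.≤ k₁ a ℚ.+ k₂ b ℚ.+ k₃ (third a b)

    solution? : ∀ k₁ k₂ k₃ a b → Dec (Solution k₁ k₂ k₃ a b)
    solution? k₁ k₂ k₃ a b =
      ¬? (+ p ∣ᶻ? a) ×-dec ¬? (+ p ∣ᶻ? b) ×-dec ¬? (+ p ∣ᶻ? third a b) ×-dec
      (0ℚ ℚ.≤? k₁ a ℚ.+ k₂ b ℚ.+ k₃ (third a b))

    solution : 5 ℕ.≤ p → ∀ {k₁ k₂ k₃} → Balanced k₁ → Balanced k₂ → Balanced k₃ →
               ∃[ a ] ∃[ b ] Solution k₁ k₂ k₃ a b
    solution 5≤p {k₁} {k₂} {k₃} bal₁ bal₂ bal₃
      with Fin.any? (λ (i : Fin p) → Fin.any? λ (j : Fin p) → solution? k₁ k₂ k₃ (+ toℕ i) (+ toℕ j))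
    ... | yes (i , j , sol) = + toℕ i , + toℕ j , sol
    ... | no  none          = ⊥-elim (¬negative 5≤p bal₁ bal₂ bal₃ negative)
      where
      residue-of : ℤ → Fin p
      residue-of a = Fin.fromℕ< (n%ℕd<d a p)

      a≡ : ∀ a → a ≡ + toℕ (residue-of a) ℤ.+ (a /ℕ p) ℤ.* + p
      a≡ a = trans (a≡a%ℕn+[a/ℕn]*n a p)
        (cong (λ r → + r ℤ.+ (a /ℕ p) ℤ.* + p) (sym (Fin.toℕ-fromℕ< (n%ℕd<d a p))))

      ∤-residue : ∀ a → ¬ + p ∣ᶻ a → ¬ + p ∣ᶻ + toℕ (residue-of a)
      ∤-residue a p∤a p∣ = p∤a (subst (+ p ∣ᶻ_) (sym (a≡ a)) (∣-add-multiple (a /ℕ p) p∣))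

      negative : Negative k₁ k₂ k₃
      negative {a} {b} {c} p∤a p∤b p∤c eq = ℚ.≰⇒> λ 0≤F → none
        ( residue-of a , residue-of b , ∤-residue a p∤a , ∤-residue b p∤b
        , (λ p∣ → p∤c (subst (+ p ∣ᶻ_) (sym c≡) (∣-add-multiple e p∣)))
        , ℚ.≤-trans 0≤F (ℚ.≤-reflexive (cong₂ ℚ._+_
            (cong₂ ℚ._+_ (trans (cong k₁ (a≡ a)) (periodic bal₁ a′ (a /ℕ p)))
                         (trans (cong k₂ (a≡ b)) (periodic bal₂ b′ (b /ℕ p))))
            (trans (cong k₃ c≡) (periodic bal₃ (third a′ b′) e)))))
        where
        a′ b′ e : ℤ
        a′ = + toℕ (residue-of a)
        b′ = + toℕ (residue-of b)
        e  = ℤ.- (a /ℕ p) ℤ.- (b /ℕ p)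
        lem : ∀ a b c → c ≡ a ℤ.+ b ℤ.+ c ℤ.- a ℤ.- b
        lem = solve-∀
        lem′ : ∀ y a b s t n → y ℤ.- (a ℤ.+ s ℤ.* n) ℤ.- (b ℤ.+ t ℤ.* n) ≡
                               y ℤ.- a ℤ.- b ℤ.+ (ℤ.- s ℤ.- t) ℤ.* n
        lem′ = solve-∀
        c≡ : c ≡ third a′ b′ ℤ.+ e ℤ.* + p
        c≡ = trans (lem a b c) (trans (cong₂ (λ x z → a ℤ.+ b ℤ.+ c ℤ.- x ℤ.- z) (a≡ a) (a≡ b))
          (trans (cong (λ w → w ℤ.- (a′ ℤ.+ (a /ℕ p) ℤ.* + p) ℤ.- (b′ ℤ.+ (b /ℕ p) ℤ.* + p)) eq)
            (lem′ y a′ b′ (a /ℕ p) (b /ℕ p) (+ p))))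

module _ (p : ℕ) .{{_ : NonZero p}} (5≤p : 5 ℕ.≤ p) where

  module _ (y : ℤ) {h : ℤ → ℚ} (per : Periodic p h) (van : ∀ {a} → + p ∣ᶻ a → h a ≡ 0ℚ) where
    balance : ZeroSum.Balanced p y (λ a → φ p ℚ.* h a ℚ.+ ℚ.- residueSum p h ℚ.* nonmultiple p a)
    balance .ZeroSum.Balanced.periodic a c =
      cong₂ (λ v w → φ p ℚ.* v ℚ.+ ℚ.- residueSum p h ℚ.* w) (per a c) (nonmultiple-periodic {p} a c)
    balance .ZeroSum.Balanced.vanish p∣a =
      trans (cong₂ (λ v w → φ p ℚ.* v ℚ.+ ℚ.- residueSum p h ℚ.* w) (van p∣a) (nonmultiple-∣ p∣a))
            (lem (φ p) (ℚ.- residueSum p h))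
      where
      lem : ∀ f s → f ℚ.* 0ℚ ℚ.+ s ℚ.* 0ℚ ≡ 0ℚ
      lem = solve 2 (λ f s → f :* con 0ℚ :+ s :* con 0ℚ := con 0ℚ) refl
        where open +-*-Solver
    balance .ZeroSum.Balanced.zero-sum = begin
      Σ[ a < p ] (φ p ℚ.* h a ℚ.+ ℚ.- residueSum p h ℚ.* nonmultiple p a)
        ≡⟨ Σ-+ p (λ a → φ p ℚ.* h a) (λ a → ℚ.- residueSum p h ℚ.* nonmultiple p a) ⟩
      Σ[ a < p ] (φ p ℚ.* h a) ℚ.+ Σ[ a < p ] (ℚ.- residueSum p h ℚ.* nonmultiple p a)
        ≡⟨ cong₂ ℚ._+_ (Σ-* p (φ p) h) (Σ-* p (ℚ.- residueSum p h) (nonmultiple p)) ⟩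
      φ p ℚ.* residueSum p h ℚ.+ ℚ.- residueSum p h ℚ.* φ p
        ≡⟨ lem (φ p) (residueSum p h) ⟩
      0ℚ ∎
      where
      open ≡-Reasoning
      lem : ∀ f s → f ℚ.* s ℚ.+ ℚ.- s ℚ.* f ≡ 0ℚ
      lem = solve 2 (λ f s → f :* s :+ :- s :* f := con 0ℚ) refl
        where open +-*-Solver

  attain-average : ∀ {h₁ h₂ h₃ : ℤ → ℚ} →
    Periodic p h₁ → Periodic p h₂ → Periodic p h₃ →
    (∀ {a} → + p ∣ᶻ a → h₁ a ≡ 0ℚ) → (∀ {a} → + p ∣ᶻ a → h₂ a ≡ 0ℚ) → (∀ {a} → + p ∣ᶻ a → h₃ a ≡ 0ℚ) →
    ∀ y → ∃[ a ] ∃[ b ] ∃[ c ]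
      (¬ + p ∣ᶻ a × ¬ + p ∣ᶻ b × ¬ + p ∣ᶻ c × a ℤ.+ b ℤ.+ c ≡ y ×
       residueSum p h₁ ℚ.+ residueSum p h₂ ℚ.+ residueSum p h₃ ℚ.≤ φ p ℚ.* (h₁ a ℚ.+ h₂ b ℚ.+ h₃ c))
  attain-average {h₁} {h₂} {h₃} per₁ per₂ per₃ van₁ van₂ van₃ y
    with ZeroSum.solution p y 5≤p (balance y per₁ van₁) (balance y per₂ van₂) (balance y per₃ van₃)
  ... | a , b , p∤a , p∤b , p∤c , 0≤F =
    a , b , c , p∤a , p∤b , p∤c , ZeroSum.third-sum p y a b , (begin
      S₁ ℚ.+ S₂ ℚ.+ S₃
        ≡⟨ ℚ.+-identityʳ _ ⟨
      S₁ ℚ.+ S₂ ℚ.+ S₃ ℚ.+ 0ℚ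
        ≤⟨ ℚ.+-monoʳ-≤ (S₁ ℚ.+ S₂ ℚ.+ S₃) 0≤F ⟩
      S₁ ℚ.+ S₂ ℚ.+ S₃ ℚ.+
        ((φ p ℚ.* h₁ a ℚ.+ ℚ.- S₁ ℚ.* nonmultiple p a) ℚ.+
         (φ p ℚ.* h₂ b ℚ.+ ℚ.- S₂ ℚ.* nonmultiple p b) ℚ.+
         (φ p ℚ.* h₃ c ℚ.+ ℚ.- S₃ ℚ.* nonmultiple p c))
        ≡⟨ cong (S₁ ℚ.+ S₂ ℚ.+ S₃ ℚ.+_) (cong₂ ℚ._+_ (cong₂ ℚ._+_
             (drop (φ p ℚ.* h₁ a) S₁ p∤a) (drop (φ p ℚ.* h₂ b) S₂ p∤b)) (drop (φ p ℚ.* h₃ c) S₃ p∤c)) ⟩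
      S₁ ℚ.+ S₂ ℚ.+ S₃ ℚ.+
        ((φ p ℚ.* h₁ a ℚ.- S₁) ℚ.+ (φ p ℚ.* h₂ b ℚ.- S₂) ℚ.+ (φ p ℚ.* h₃ c ℚ.- S₃))
        ≡⟨ collect (φ p) S₁ S₂ S₃ (h₁ a) (h₂ b) (h₃ c) ⟩
      φ p ℚ.* (h₁ a ℚ.+ h₂ b ℚ.+ h₃ c) ∎)
    where
    open ℚ.≤-Reasoning
    c : ℤ
    c = ZeroSum.third p y a b
    S₁ S₂ S₃ : ℚ
    S₁ = residueSum p h₁
    S₂ = residueSum p h₂
    S₃ = residueSum p h₃
    drop : ∀ v s {e} → ¬ + p ∣ᶻ e → v ℚ.+ ℚ.- s ℚ.* nonmultiple p e ≡ v ℚ.- s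
    drop v s p∤e = cong (v ℚ.+_) (trans (cong (ℚ.- s ℚ.*_) (nonmultiple-∤ p∤e)) (ℚ.*-identityʳ (ℚ.- s)))
    collect : ∀ f s t r a b c → s ℚ.+ t ℚ.+ r ℚ.+ ((f ℚ.* a ℚ.- s) ℚ.+ (f ℚ.* b ℚ.- t) ℚ.+ (f ℚ.* c ℚ.- r)) ≡
                                f ℚ.* (a ℚ.+ b ℚ.+ c)
    collect = solve 7 (λ f s t r a b c →
      s :+ t :+ r :+ ((f :* a :- s) :+ (f :* b :- t) :+ (f :* c :- r)) := f :* (a :+ b :+ c)) refl
      where open +-*-Solver

Σ-split : ∀ m n (h : ℤ → ℚ) → residueSum (m ℕ.+ n) h ≡ residueSum m h ℚ.+ Σ[ a < n ] h (+ m ℤ.+ a)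
Σ-split zero    n h = trans (Σ-cong n λ a → cong h (sym (ℤ.+-identityˡ a))) (sym (ℚ.+-identityˡ _))
Σ-split (suc m) n h = begin
  h 0ℤ ℚ.+ Σ[ a < m ℕ.+ n ] h (1ℤ ℤ.+ a)
    ≡⟨ cong (h 0ℤ ℚ.+_) (Σ-split m n (λ a → h (1ℤ ℤ.+ a))) ⟩
  h 0ℤ ℚ.+ (Σ[ a < m ] h (1ℤ ℤ.+ a) ℚ.+ Σ[ a < n ] h (1ℤ ℤ.+ (+ m ℤ.+ a)))
    ≡⟨ ℚ.+-assoc (h 0ℤ) (Σ[ a < m ] h (1ℤ ℤ.+ a)) (Σ[ a < n ] h (1ℤ ℤ.+ (+ m ℤ.+ a))) ⟨
  residueSum (suc m) h ℚ.+ Σ[ a < n ] h (1ℤ ℤ.+ (+ m ℤ.+ a))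
    ≡⟨ cong (residueSum (suc m) h ℚ.+_) (Σ-cong n λ a → cong h (sym (ℤ.+-assoc 1ℤ (+ m) a))) ⟩
  residueSum (suc m) h ℚ.+ Σ[ a < n ] h (+ suc m ℤ.+ a) ∎
  where open ≡-Reasoning

Σ-blocks : ∀ p q (h : ℤ → ℚ) → residueSum (p ℕ.* q) h ≡ Σ[ b < p ] Σ[ d < q ] h (b ℤ.+ + p ℤ.* d)
Σ-blocks p q h = begin
  residueSum (p ℕ.* q) h                       ≡⟨ cong (λ n → residueSum n h) (ℕ.*-comm p q) ⟩
  residueSum (q ℕ.* p) h                       ≡⟨ go q h ⟩
  Σ[ d < q ] Σ[ b < p ] h (b ℤ.+ + p ℤ.* d)    ≡⟨ Σ-comm q p (λ d b → h (b ℤ.+ + p ℤ.* d)) ⟩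
  Σ[ b < p ] Σ[ d < q ] h (b ℤ.+ + p ℤ.* d)    ∎
  where
  open ≡-Reasoning
  first : ∀ b p → b ≡ b ℤ.+ p ℤ.* 0ℤ
  first = solve-∀
  next : ∀ b p d → p ℤ.+ (b ℤ.+ p ℤ.* d) ≡ b ℤ.+ p ℤ.* (1ℤ ℤ.+ d)
  next = solve-∀
  go : ∀ q (h : ℤ → ℚ) → residueSum (q ℕ.* p) h ≡ Σ[ d < q ] Σ[ b < p ] h (b ℤ.+ + p ℤ.* d)
  go zero    h = refl
  go (suc q) h = begin
    residueSum (p ℕ.+ q ℕ.* p) h
      ≡⟨ Σ-split p (q ℕ.* p) h ⟩
    residueSum p h ℚ.+ Σ[ a < q ℕ.* p ] h (+ p ℤ.+ a)
      ≡⟨ cong₂ ℚ._+_ (Σ-cong p λ b → cong h (first b (+ p))) (go q (λ a → h (+ p ℤ.+ a))) ⟩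
    Σ[ b < p ] h (b ℤ.+ + p ℤ.* 0ℤ) ℚ.+ Σ[ d < q ] Σ[ b < p ] h (+ p ℤ.+ (b ℤ.+ + p ℤ.* d))
      ≡⟨ cong (Σ[ b < p ] h (b ℤ.+ + p ℤ.* 0ℤ) ℚ.+_)
           (Σ-cong q λ d → Σ-cong p λ b → cong h (next b (+ p) d)) ⟩
    Σ[ b < p ] h (b ℤ.+ + p ℤ.* 0ℤ) ℚ.+ Σ[ d < q ] Σ[ b < p ] h (b ℤ.+ + p ℤ.* (1ℤ ℤ.+ d)) ∎

-- Lifting along prime factors

record Congruent (m : ℕ) (a b : ℤ) : Set where
  constructor congruent
  field ∣-difference : + m ∣ᶻ a ℤ.- b


module _ {m : ℕ} where

  Congruent-sym : ∀ {a b} → Congruent m a b → Congruent m b a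
  Congruent-sym {a} {b} (congruent m∣) = congruent (subst (+ m ∣ᶻ_) (lem a b) (ℤ∣.∣m⇒∣-m m∣))
    where
    lem : ∀ a b → ℤ.- (a ℤ.- b) ≡ b ℤ.- a
    lem = solve-∀

  Congruent-trans : ∀ {a b c} → Congruent m a b → Congruent m b c → Congruent m a c
  Congruent-trans {a} {b} {c} (congruent m∣) (congruent m∣′) =
    congruent (subst (+ m ∣ᶻ_) (lem a b c) (ℤ∣.∣m∣n⇒∣m+n m∣ m∣′))
    where
    lem : ∀ a b c → (a ℤ.- b) ℤ.+ (b ℤ.- c) ≡ a ℤ.- c
    lem = solve-∀

  Congruent-+ : ∀ {a b c d} → Congruent m a b → Congruent m c d → Congruent m (a ℤ.+ c) (b ℤ.+ d)
  Congruent-+ {a} {b} {c} {d} (congruent m∣) (congruent m∣′) =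
    congruent (subst (+ m ∣ᶻ_) (lem a b c d) (ℤ∣.∣m∣n⇒∣m+n m∣ m∣′))
    where
    lem : ∀ a b c d → (a ℤ.- b) ℤ.+ (c ℤ.- d) ≡ (a ℤ.+ c) ℤ.- (b ℤ.+ d)
    lem = solve-∀

  Congruent-∣ : ∀ {p a b} → + p ∣ᶻ + m → Congruent m a b → + p ∣ᶻ a → + p ∣ᶻ b
  Congruent-∣ {p} {a} {b} p∣m (congruent m∣) p∣a =
    subst (+ p ∣ᶻ_) (lem a b) (ℤ∣.∣m∣n⇒∣m-n p∣a (ℤ∣.∣-trans p∣m m∣))
    where
    lem : ∀ a b → a ℤ.- (a ℤ.- b) ≡ b
    lem = solve-∀

Congruent-weaken : ∀ {m n a b} → n ∣ m → Congruent m a b → Congruent n a b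
Congruent-weaken n∣m (congruent m∣) = congruent (ℤ∣.∣-trans (ℤ∣.∣ᵤ⇒∣ n∣m) m∣)

inverse-mod : ∀ {n p} → Coprime n p → ∃[ v ] (+ p ∣ᶻ + n ℤ.* v ℤ.- 1ℤ)
inverse-mod {n} {p} n⊥p with coprime-Bézout n⊥p
... | Bézout.+- v w eq = + v , divides (+ w) (begin
  + n ℤ.* + v ℤ.- 1ℤ                 ≡⟨ cong (ℤ._- 1ℤ) (trans (ℤ.*-comm (+ n) (+ v)) (sym (ℤ.pos-* v n))) ⟩
  + (v ℕ.* n) ℤ.- 1ℤ                 ≡⟨ cong (λ k → + k ℤ.- 1ℤ) eq ⟨
  1ℤ ℤ.+ + (w ℕ.* p) ℤ.- 1ℤ          ≡⟨ cong (λ k → 1ℤ ℤ.+ k ℤ.- 1ℤ) (ℤ.pos-* w p) ⟩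
  1ℤ ℤ.+ + w ℤ.* + p ℤ.- 1ℤ          ≡⟨ lem (+ w ℤ.* + p) ⟩
  + w ℤ.* + p                        ∎)
  where
  open ≡-Reasoning
  lem : ∀ k → 1ℤ ℤ.+ k ℤ.- 1ℤ ≡ k
  lem = solve-∀
... | Bézout.-+ v w eq = ℤ.- + v , divides (ℤ.- + w) (begin
  + n ℤ.* ℤ.- + v ℤ.- 1ℤ             ≡⟨ lem (+ n) (+ v) ⟩
  ℤ.- (1ℤ ℤ.+ + v ℤ.* + n)           ≡⟨ cong (λ k → ℤ.- (1ℤ ℤ.+ k)) (ℤ.pos-* v n) ⟨
  ℤ.- (+ (1 ℕ.+ v ℕ.* n))            ≡⟨ cong (λ k → ℤ.- (+ k)) eq ⟩
  ℤ.- (+ (w ℕ.* p))                  ≡⟨ cong ℤ.-_ (ℤ.pos-* w p) ⟩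
  ℤ.- (+ w ℤ.* + p)                  ≡⟨ ℤ.neg-distribˡ-* (+ w) (+ p) ⟩
  ℤ.- + w ℤ.* + p                    ∎)
  where
  open ≡-Reasoning
  lem : ∀ n v → n ℤ.* ℤ.- v ℤ.- 1ℤ ≡ ℤ.- (1ℤ ℤ.+ v ℤ.* n)
  lem = solve-∀

Avoids Meets : List ℕ → ℤ → Set
Avoids ps a = All (λ p → ¬ + p ∣ᶻ a) ps
Meets ps a = Any (λ p → + p ∣ᶻ a) ps

Vanishes : List ℕ → (ℤ → ℚ) → Set
Vanishes ps g = ∀ {a} → Meets ps a → g a ≡ 0ℚ

fibreSum : ℕ → ℕ → (ℤ → ℚ) → ℤ → ℚ
fibreSum n q g a = Σ[ c < q ] g (a ℤ.+ + n ℤ.* c)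

Φ : List ℕ → ℚ
Φ []       = 1ℚ
Φ (p ∷ ps) = φ p ℚ.* Φ ps

fibreSum-periodic : ∀ n q {N g} → n ℕ.* q ≡ N → Periodic N g → Periodic n (fibreSum n q g)
fibreSum-periodic n q {N} {g} nq≡N per a c = begin
  Σ[ d < q ] g (a ℤ.+ c ℤ.* + n ℤ.+ + n ℤ.* d)   ≡⟨ Σ-cong q (λ d → cong g (lem a c (+ n) d)) ⟩
  Σ[ d < q ] g (a ℤ.+ + n ℤ.* (c ℤ.+ d))         ≡⟨ Σ-shift q fibre-periodic c ⟩
  Σ[ d < q ] g (a ℤ.+ + n ℤ.* d)                 ∎
  where
  open ≡-Reasoning
  lem : ∀ a c n d → a ℤ.+ c ℤ.* n ℤ.+ n ℤ.* d ≡ a ℤ.+ n ℤ.* (c ℤ.+ d)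
  lem = solve-∀
  fibre-periodic : Periodic q (λ d → g (a ℤ.+ + n ℤ.* d))
  fibre-periodic d e = begin
    g (a ℤ.+ + n ℤ.* (d ℤ.+ e ℤ.* + q))          ≡⟨ cong g (lem′ a (+ n) d e (+ q)) ⟩
    g (a ℤ.+ + n ℤ.* d ℤ.+ e ℤ.* (+ n ℤ.* + q))  ≡⟨ cong (λ k → g (a ℤ.+ + n ℤ.* d ℤ.+ e ℤ.* k))
                                                      (trans (sym (ℤ.pos-* n q)) (cong +_ nq≡N)) ⟩
    g (a ℤ.+ + n ℤ.* d ℤ.+ e ℤ.* + N)            ≡⟨ per (a ℤ.+ + n ℤ.* d) e ⟩
    g (a ℤ.+ + n ℤ.* d)                          ∎
    where
    lem′ : ∀ a n d e q → a ℤ.+ n ℤ.* (d ℤ.+ e ℤ.* q) ≡ a ℤ.+ n ℤ.* d ℤ.+ e ℤ.* (n ℤ.* q)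
    lem′ = solve-∀

-- Reading the fibre of a modulo p along c = z + b, where p ∣ a + n z.
module Fibre (n p : ℕ) (v : ℤ) (p∣nv-1 : + p ∣ᶻ + n ℤ.* v ℤ.- 1ℤ) (a : ℤ) where

  origin : ℤ
  origin = ℤ.- a ℤ.* v

  point : ℤ → ℤ
  point b = a ℤ.+ + n ℤ.* (origin ℤ.+ b)

  private
    split : ∀ b → point b ≡ ℤ.- a ℤ.* (+ n ℤ.* v ℤ.- 1ℤ) ℤ.+ + n ℤ.* b
    split b = lem a (+ n) v b
      where
      lem : ∀ a n v b → a ℤ.+ n ℤ.* (ℤ.- a ℤ.* v ℤ.+ b) ≡ ℤ.- a ℤ.* (n ℤ.* v ℤ.- 1ℤ) ℤ.+ n ℤ.* b
      lem = solve-∀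

  ∣⇒∣-point : ∀ {b} → + p ∣ᶻ b → + p ∣ᶻ point b
  ∣⇒∣-point {b} p∣b = subst (+ p ∣ᶻ_) (sym (split b))
    (ℤ∣.∣m∣n⇒∣m+n (ℤ∣.∣n⇒∣m*n (ℤ.- a) p∣nv-1) (ℤ∣.∣n⇒∣m*n (+ n) p∣b))

  ∣-point⇒∣ : ∀ {b} → + p ∣ᶻ point b → + p ∣ᶻ b
  ∣-point⇒∣ {b} p∣ = subst (+ p ∣ᶻ_) (lem (+ n) v b)
    (ℤ∣.∣m∣n⇒∣m-n (ℤ∣.∣m⇒∣m*n v p∣nb) (ℤ∣.∣m⇒∣m*n b p∣nv-1))
    where
    p∣nb : + p ∣ᶻ + n ℤ.* b
    p∣nb = ℤ∣.∣m+n∣m⇒∣n {+ p} {ℤ.- a ℤ.* (+ n ℤ.* v ℤ.- 1ℤ)} (subst (+ p ∣ᶻ_) (split b) p∣) (ℤ∣.∣n⇒∣m*n (ℤ.- a) p∣nv-1)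
    lem : ∀ n v b → n ℤ.* b ℤ.* v ℤ.- (n ℤ.* v ℤ.- 1ℤ) ℤ.* b ≡ b
    lem = solve-∀

  module _ (q : ℕ) {N : ℕ} {g : ℤ → ℚ} (npq≡N : n ℕ.* (p ℕ.* q) ≡ N) (per : Periodic N g) where

    fibre : ℤ → ℚ
    fibre b = fibreSum (n ℕ.* p) q g (point b)

    private
      G-periodic : Periodic (n ℕ.* p) (fibreSum (n ℕ.* p) q g)
      G-periodic = fibreSum-periodic (n ℕ.* p) q (trans (ℕ.*-assoc n p q) npq≡N) per

      along : ∀ e → Periodic p (λ b → fibreSum (n ℕ.* p) q g (e ℤ.+ + n ℤ.* b))
      along e b c = trans (cong (fibreSum (n ℕ.* p) q g)
          (trans (lem e (+ n) b c (+ p)) (cong (λ k → e ℤ.+ + n ℤ.* b ℤ.+ c ℤ.* k) (sym (ℤ.pos-* n p)))))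
        (G-periodic (e ℤ.+ + n ℤ.* b) c)
        where
        lem : ∀ e n b c p → e ℤ.+ n ℤ.* (b ℤ.+ c ℤ.* p) ≡ e ℤ.+ n ℤ.* b ℤ.+ c ℤ.* (n ℤ.* p)
        lem = solve-∀

    fibre-periodic : Periodic p fibre
    fibre-periodic = Periodic-shift origin (along a)

    Σ-fibre : residueSum p fibre ≡ fibreSum n (p ℕ.* q) g a
    Σ-fibre = begin
      Σ[ b < p ] fibreSum (n ℕ.* p) q g (a ℤ.+ + n ℤ.* (origin ℤ.+ b))
        ≡⟨ Σ-shift p (along a) origin ⟩
      Σ[ b < p ] Σ[ d < q ] g (a ℤ.+ + n ℤ.* b ℤ.+ + (n ℕ.* p) ℤ.* d)
        ≡⟨ Σ-cong p (λ b → Σ-cong q λ d → cong g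
             (trans (cong (λ k → a ℤ.+ + n ℤ.* b ℤ.+ k ℤ.* d) (ℤ.pos-* n p)) (lem a (+ n) b (+ p) d))) ⟩
      Σ[ b < p ] Σ[ d < q ] g (a ℤ.+ + n ℤ.* (b ℤ.+ + p ℤ.* d))
        ≡⟨ Σ-blocks p q (λ c → g (a ℤ.+ + n ℤ.* c)) ⟨
      fibreSum n (p ℕ.* q) g a ∎
      where
      open ≡-Reasoning
      lem : ∀ a n b p d → a ℤ.+ n ℤ.* b ℤ.+ n ℤ.* p ℤ.* d ≡ a ℤ.+ n ℤ.* (b ℤ.+ p ℤ.* d)
      lem = solve-∀

    fibre-vanishes : (∀ {b} → + p ∣ᶻ b → g b ≡ 0ℚ) → ∀ {b} → + p ∣ᶻ b → fibre b ≡ 0ℚ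
    fibre-vanishes van {b} p∣b =
      trans (Σ-cong q λ d → van (ℤ∣.∣m∣n⇒∣m+n (∣⇒∣-point p∣b)
              (ℤ∣.∣m⇒∣m*n d (subst (+ p ∣ᶻ_) (sym (ℤ.pos-* n p)) (ℤ∣.∣n⇒∣m*n (+ n) ℤ∣.∣-refl)))))
            (Sum.sum-replicate-zero q)

record Lifted (ps : List ℕ) (n N : ℕ) (g₁ g₂ g₃ : ℤ → ℚ) (a₁ a₂ a₃ x : ℤ) : Set where
  field
    b₁ b₂ b₃ : ℤ
    over₁   : Congruent n b₁ a₁
    over₂   : Congruent n b₂ a₂
    over₃   : Congruent n b₃ a₃
    avoids₁ : Avoids ps b₁
    avoids₂ : Avoids ps b₂
    avoids₃ : Avoids ps b₃
    target  : Congruent N (b₁ ℤ.+ b₂ ℤ.+ b₃) x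
    average≤ : fibreSum n (product ps) g₁ a₁ ℚ.+ fibreSum n (product ps) g₂ a₂ ℚ.+
               fibreSum n (product ps) g₃ a₃ ℚ.≤ Φ ps ℚ.* (g₁ b₁ ℚ.+ g₂ b₂ ℚ.+ g₃ b₃)

lift : ∀ ps {n N} → n ℕ.* product ps ≡ N → Squarefree N → All (5 ℕ.≤_) ps →
  ∀ {g₁ g₂ g₃} → Periodic N g₁ → Periodic N g₂ → Periodic N g₃ →
  Vanishes ps g₁ → Vanishes ps g₂ → Vanishes ps g₃ →
  ∀ a₁ a₂ a₃ x → Congruent n (a₁ ℤ.+ a₂ ℤ.+ a₃) x → Lifted ps n N g₁ g₂ g₃ a₁ a₂ a₃ x
lift [] {n} {N} n≡N _ [] {g₁} {g₂} {g₃} _ _ _ _ _ _ a₁ a₂ a₃ x ≡x = record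
  { b₁ = a₁ ; b₂ = a₂ ; b₃ = a₃
  ; over₁ = self a₁ ; over₂ = self a₂ ; over₃ = self a₃
  ; avoids₁ = [] ; avoids₂ = [] ; avoids₃ = []
  ; target = subst (λ k → Congruent k (a₁ ℤ.+ a₂ ℤ.+ a₃) x) (trans (sym (ℕ.*-identityʳ n)) n≡N) ≡x
  ; average≤ = ℚ.≤-reflexive (trans (cong₂ ℚ._+_ (cong₂ ℚ._+_ (fibreSum₁ g₁ a₁) (fibreSum₁ g₂ a₂)) (fibreSum₁ g₃ a₃))
                                    (sym (ℚ.*-identityˡ (g₁ a₁ ℚ.+ g₂ a₂ ℚ.+ g₃ a₃))))
  }
  where
  self : ∀ a → Congruent n a a
  self a = congruent (divides 0ℤ (ℤ.+-inverseʳ a))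
  fibreSum₁ : ∀ g a → fibreSum n 1 g a ≡ g a
  fibreSum₁ g a = trans (ℚ.+-identityʳ _) (cong g (lem a (+ n)))
    where
    lem : ∀ a n → a ℤ.+ n ℤ.* 0ℤ ≡ a
    lem = solve-∀
lift (p ∷ ps) {n} {N} npq≡N sqf (5≤p ∷ 5≤ps) {g₁} {g₂} {g₃}
  per₁ per₂ per₃ van₁ van₂ van₃ a₁ a₂ a₃ x (congruent (divides t a≡x)) =
  from-attained (attain-average p 5≤p {h₁} {h₂} {h₃}
    (F₁.fibre-periodic q npq≡N per₁) (F₂.fibre-periodic q npq≡N per₂) (F₃.fibre-periodic q npq≡N per₃)
    (F₁.fibre-vanishes q npq≡N per₁ (van₁ ∘ here)) (F₂.fibre-vanishes q npq≡N per₂ (van₂ ∘ here))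
    (F₃.fibre-vanishes q npq≡N per₃ (van₃ ∘ here)) y)
  where
  instance
    p-nonZero : NonZero p
    p-nonZero = ℕ.>-nonZero (ℕ.<-≤-trans ℕ.z<s 5≤p)

  q : ℕ
  q = product ps

  n⊥p : Coprime n p
  n⊥p {d} (d∣n , d∣p) = sqf d (subst (d ℕ.* d ∣_) npq≡N (ℕ.*-pres-∣ d∣n (ℕ.∣m⇒∣m*n q d∣p)))

  module F₁ = Fibre n p (inverse-mod n⊥p .proj₁) (inverse-mod n⊥p .proj₂) a₁
  module F₂ = Fibre n p (inverse-mod n⊥p .proj₁) (inverse-mod n⊥p .proj₂) a₂
  module F₃ = Fibre n p (inverse-mod n⊥p .proj₁) (inverse-mod n⊥p .proj₂) a₃

  y : ℤ
  y = ℤ.- t ℤ.- (F₁.origin ℤ.+ F₂.origin ℤ.+ F₃.origin)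

  on-target : ∀ b₁ b₂ b₃ → b₁ ℤ.+ b₂ ℤ.+ b₃ ≡ y →
              F₁.point b₁ ℤ.+ F₂.point b₂ ℤ.+ F₃.point b₃ ℤ.- x ≡ 0ℤ ℤ.* + (n ℕ.* p)
  on-target b₁ b₂ b₃ Σb≡y = begin
    F₁.point b₁ ℤ.+ F₂.point b₂ ℤ.+ F₃.point b₃ ℤ.- x
      ≡⟨ lem a₁ a₂ a₃ F₁.origin F₂.origin F₃.origin b₁ b₂ b₃ (+ n) x ⟩
    a₁ ℤ.+ a₂ ℤ.+ a₃ ℤ.- x ℤ.+ + n ℤ.* (F₁.origin ℤ.+ F₂.origin ℤ.+ F₃.origin ℤ.+ (b₁ ℤ.+ b₂ ℤ.+ b₃))
      ≡⟨ cong₂ (λ k l → k ℤ.+ + n ℤ.* (F₁.origin ℤ.+ F₂.origin ℤ.+ F₃.origin ℤ.+ l)) a≡x Σb≡y ⟩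
    t ℤ.* + n ℤ.+ + n ℤ.* (F₁.origin ℤ.+ F₂.origin ℤ.+ F₃.origin ℤ.+ y)
      ≡⟨ lem′ t (+ n) (F₁.origin ℤ.+ F₂.origin ℤ.+ F₃.origin) (+ (n ℕ.* p)) ⟩
    0ℤ ℤ.* + (n ℕ.* p) ∎
    where
    open ≡-Reasoning
    lem : ∀ a₁ a₂ a₃ o₁ o₂ o₃ b₁ b₂ b₃ n x →
      (a₁ ℤ.+ n ℤ.* (o₁ ℤ.+ b₁)) ℤ.+ (a₂ ℤ.+ n ℤ.* (o₂ ℤ.+ b₂)) ℤ.+ (a₃ ℤ.+ n ℤ.* (o₃ ℤ.+ b₃)) ℤ.- x ≡
      a₁ ℤ.+ a₂ ℤ.+ a₃ ℤ.- x ℤ.+ n ℤ.* (o₁ ℤ.+ o₂ ℤ.+ o₃ ℤ.+ (b₁ ℤ.+ b₂ ℤ.+ b₃))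
    lem = solve-∀
    lem′ : ∀ t n o m → t ℤ.* n ℤ.+ n ℤ.* (o ℤ.+ (ℤ.- t ℤ.- o)) ≡ 0ℤ ℤ.* m
    lem′ = solve-∀

  point-Congruent : ∀ a o b → Congruent n (a ℤ.+ + n ℤ.* (o ℤ.+ b)) a
  point-Congruent a o b = congruent (divides (o ℤ.+ b) (lem a (+ n) (o ℤ.+ b)))
    where
    lem : ∀ a n c → a ℤ.+ n ℤ.* c ℤ.- a ≡ c ℤ.* n
    lem = solve-∀

  over : ∀ {e} a o b → Congruent (n ℕ.* p) e (a ℤ.+ + n ℤ.* (o ℤ.+ b)) → Congruent n e a
  over a o b e≡ = Congruent-trans (Congruent-weaken (ℕ.m∣m*n p) e≡) (point-Congruent a o b)

  avoid : ∀ {e f} → Congruent (n ℕ.* p) e f → ¬ + p ∣ᶻ f → ¬ + p ∣ᶻ e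
  avoid e≡f p∤f p∣e = p∤f (Congruent-∣ (ℤ∣.∣ᵤ⇒∣ (ℕ.n∣m*n n)) e≡f p∣e)

  h₁ h₂ h₃ : ℤ → ℚ
  h₁ = F₁.fibre q npq≡N per₁
  h₂ = F₂.fibre q npq≡N per₂
  h₃ = F₃.fibre q npq≡N per₃

  from-lifted : ∀ {b₁ b₂ b₃} → ¬ + p ∣ᶻ b₁ → ¬ + p ∣ᶻ b₂ → ¬ + p ∣ᶻ b₃ →
    residueSum p h₁ ℚ.+ residueSum p h₂ ℚ.+ residueSum p h₃ ℚ.≤ φ p ℚ.* (h₁ b₁ ℚ.+ h₂ b₂ ℚ.+ h₃ b₃) →
    Lifted ps (n ℕ.* p) N g₁ g₂ g₃ (F₁.point b₁) (F₂.point b₂) (F₃.point b₃) x →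
    Lifted (p ∷ ps) n N g₁ g₂ g₃ a₁ a₂ a₃ x
  from-lifted {b₁} {b₂} {b₃} p∤b₁ p∤b₂ p∤b₃ S≤ l = record
    { b₁ = L.b₁ ; b₂ = L.b₂ ; b₃ = L.b₃
    ; over₁ = over a₁ F₁.origin b₁ L.over₁
    ; over₂ = over a₂ F₂.origin b₂ L.over₂
    ; over₃ = over a₃ F₃.origin b₃ L.over₃
    ; avoids₁ = avoid L.over₁ (p∤b₁ ∘ F₁.∣-point⇒∣) ∷ L.avoids₁
    ; avoids₂ = avoid L.over₂ (p∤b₂ ∘ F₂.∣-point⇒∣) ∷ L.avoids₂
    ; avoids₃ = avoid L.over₃ (p∤b₃ ∘ F₃.∣-point⇒∣) ∷ L.avoids₃
    ; target = L.target
    ; average≤ = begin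
        fibreSum n (p ℕ.* q) g₁ a₁ ℚ.+ fibreSum n (p ℕ.* q) g₂ a₂ ℚ.+ fibreSum n (p ℕ.* q) g₃ a₃
          ≡⟨ cong₂ ℚ._+_ (cong₂ ℚ._+_ (F₁.Σ-fibre q npq≡N per₁) (F₂.Σ-fibre q npq≡N per₂)) (F₃.Σ-fibre q npq≡N per₃) ⟨
        residueSum p h₁ ℚ.+ residueSum p h₂ ℚ.+ residueSum p h₃
          ≤⟨ S≤ ⟩
        φ p ℚ.* (h₁ b₁ ℚ.+ h₂ b₂ ℚ.+ h₃ b₃)
          ≤⟨ ℚ.*-monoˡ-≤-nonNeg (φ p) {{ℚ.nonNegative (ℚ.<⇒≤ (0<φ p 5≤p))}} L.average≤ ⟩
        φ p ℚ.* (Φ ps ℚ.* (g₁ L.b₁ ℚ.+ g₂ L.b₂ ℚ.+ g₃ L.b₃))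
          ≡⟨ ℚ.*-assoc (φ p) (Φ ps) (g₁ L.b₁ ℚ.+ g₂ L.b₂ ℚ.+ g₃ L.b₃) ⟨
        φ p ℚ.* Φ ps ℚ.* (g₁ L.b₁ ℚ.+ g₂ L.b₂ ℚ.+ g₃ L.b₃) ∎
    }
    where
    open ℚ.≤-Reasoning
    module L = Lifted l

  from-attained : ∃[ b₁ ] ∃[ b₂ ] ∃[ b₃ ] (¬ + p ∣ᶻ b₁ × ¬ + p ∣ᶻ b₂ × ¬ + p ∣ᶻ b₃ × b₁ ℤ.+ b₂ ℤ.+ b₃ ≡ y ×
    residueSum p h₁ ℚ.+ residueSum p h₂ ℚ.+ residueSum p h₃ ℚ.≤ φ p ℚ.* (h₁ b₁ ℚ.+ h₂ b₂ ℚ.+ h₃ b₃)) →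
    Lifted (p ∷ ps) n N g₁ g₂ g₃ a₁ a₂ a₃ x
  from-attained (b₁ , b₂ , b₃ , p∤b₁ , p∤b₂ , p∤b₃ , Σb≡y , S≤) = from-lifted p∤b₁ p∤b₂ p∤b₃ S≤
    (lift ps {n ℕ.* p} (trans (ℕ.*-assoc n p q) npq≡N) sqf 5≤ps per₁ per₂ per₃
      (van₁ ∘ there) (van₂ ∘ there) (van₃ ∘ there)
      (F₁.point b₁) (F₂.point b₂) (F₃.point b₃) x (congruent (divides 0ℤ (on-target b₁ b₂ b₃ Σb≡y))))

-- Averages over lists of residues

listSum : ∀ {A : Set} → (A → ℚ) → List A → ℚ
listSum k = foldr (λ u s → k u ℚ.+ s) 0ℚ

fromℕℚ : ℕ → ℚ
fromℕℚ n = ℚ.fromℚᵘ (mkℚᵘ (+ n) 0)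

fromℚᵘ-+ : ∀ p q → ℚ.fromℚᵘ (p ℚᵘ.+ q) ≡ ℚ.fromℚᵘ p ℚ.+ ℚ.fromℚᵘ q
fromℚᵘ-+ p q = ℚ.toℚᵘ-injective (ℚᵘ.≃-trans (ℚ.toℚᵘ-fromℚᵘ (p ℚᵘ.+ q)) (ℚᵘ.≃-sym
  (ℚᵘ.≃-trans (ℚ.toℚᵘ-homo-+ (ℚ.fromℚᵘ p) (ℚ.fromℚᵘ q))
              (ℚᵘ.+-cong (ℚ.toℚᵘ-fromℚᵘ p) (ℚ.toℚᵘ-fromℚᵘ q)))))

fromℚᵘ-* : ∀ p q → ℚ.fromℚᵘ (p ℚᵘ.* q) ≡ ℚ.fromℚᵘ p ℚ.* ℚ.fromℚᵘ q
fromℚᵘ-* p q = ℚ.toℚᵘ-injective (ℚᵘ.≃-trans (ℚ.toℚᵘ-fromℚᵘ (p ℚᵘ.* q)) (ℚᵘ.≃-sym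
  (ℚᵘ.≃-trans (ℚ.toℚᵘ-homo-* (ℚ.fromℚᵘ p) (ℚ.fromℚᵘ q))
              (ℚᵘ.*-cong (ℚ.toℚᵘ-fromℚᵘ p) (ℚ.toℚᵘ-fromℚᵘ q)))))

fromℕℚ-suc : ∀ n → fromℕℚ (suc n) ≡ 1ℚ ℚ.+ fromℕℚ n
fromℕℚ-suc n = trans (ℚ.fromℚᵘ-cong {mkℚᵘ (+ suc n) 0} {mkℚᵘ (+ 1) 0 ℚᵘ.+ mkℚᵘ (+ n) 0} (*≡* (lem (+ n))))
                     (fromℚᵘ-+ (mkℚᵘ (+ 1) 0) (mkℚᵘ (+ n) 0))
  where
  lem : ∀ n → (1ℤ ℤ.+ n) ℤ.* 1ℤ ≡ (1ℤ ℤ.* 1ℤ ℤ.+ n ℤ.* 1ℤ) ℤ.* 1ℤ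
  lem = solve-∀

1/n*n : ∀ n .{{_ : NonZero n}} → (+ 1 / n) ℚ.* fromℕℚ n ≡ 1ℚ
1/n*n (suc n) = trans (sym (fromℚᵘ-* (mkℚᵘ (+ 1) n) (mkℚᵘ (+ suc n) 0)))
                      (ℚ.fromℚᵘ-cong {mkℚᵘ (+ 1) n ℚᵘ.* mkℚᵘ (+ suc n) 0} {mkℚᵘ (+ 1) 0}
                        (*≡* (trans (lem (+ suc n)) (cong (λ k → 1ℤ ℤ.* + k) (sym (ℕ.*-identityʳ (suc n)))))))
  where
  lem : ∀ n → 1ℤ ℤ.* n ℤ.* 1ℤ ≡ 1ℤ ℤ.* n
  lem = solve-∀

module _ {A : Set} where

  listSum-filter : ∀ {P : A → Set} (P? : Decidable P) k xs →
    listSum k (filter P? xs) ≡ listSum (λ u → if does (P? u) then k u else 0ℚ) xs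
  listSum-filter P? k []       = refl
  listSum-filter P? k (x ∷ xs) with does (P? x)
  ... | true  = cong (k x ℚ.+_) (listSum-filter P? k xs)
  ... | false = trans (listSum-filter P? k xs) (sym (ℚ.+-identityˡ _))

  listSum-mapMaybe : ∀ {B : Set} (r : B → Maybe A) k ys →
    listSum k (mapMaybe r ys) ≡ listSum (λ y → maybe′ k 0ℚ (r y)) ys
  listSum-mapMaybe r k []       = refl
  listSum-mapMaybe r k (y ∷ ys) with r y
  ... | just u  = cong (k u ℚ.+_) (listSum-mapMaybe r k ys)
  ... | nothing = trans (listSum-mapMaybe r k ys) (sym (ℚ.+-identityˡ _))

  listSum-tabulate : ∀ {n} (k : A → ℚ) (g : Fin n → A) → listSum k (tabulate g) ≡ Sum.sum {n} (k ∘ g)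
  listSum-tabulate {zero}  k g = refl
  listSum-tabulate {suc n} k g = cong (k (g Fin.zero) ℚ.+_) (listSum-tabulate k (g ∘ Fin.suc))

  listSum-minus : ∀ k c (xs : List A) → listSum (λ u → k u ℚ.- c) xs ≡ listSum k xs ℚ.- c ℚ.* fromℕℚ (length xs)
  listSum-minus k c []       = lem c
    where
    lem : ∀ c → 0ℚ ≡ 0ℚ ℚ.- c ℚ.* 0ℚ
    lem = solve 1 (λ c → con 0ℚ := con 0ℚ :- c :* con 0ℚ) refl
      where open +-*-Solver
  listSum-minus k c (x ∷ xs) = trans (cong (k x ℚ.- c ℚ.+_) (listSum-minus k c xs))
    (trans (lem (k x) c (listSum k xs) (fromℕℚ (length xs)))
      (cong (λ l → k x ℚ.+ listSum k xs ℚ.- c ℚ.* l) (sym (fromℕℚ-suc (length xs)))))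
    where
    lem : ∀ k c s l → k ℚ.- c ℚ.+ (s ℚ.- c ℚ.* l) ≡ k ℚ.+ s ℚ.- c ℚ.* (1ℚ ℚ.+ l)
    lem = solve 4 (λ k c s l → k :- c :+ (s :- c :* l) := k :+ s :- c :* (con 1ℚ :+ l)) refl
      where open +-*-Solver

  seq-foldr : ∀ (f : A → ℝ) n xs → seq (foldr _+ℝ_ (fromℚ 0ℚ) (map f xs)) n ≡ listSum (λ u → seq (f u) n) xs
  seq-foldr f n []       = refl
  seq-foldr f n (x ∷ xs) = cong (seq (f x) n ℚ.+_) (seq-foldr f n xs)

  listSum-deviation : ∀ (f : A → ℝ) n xs →
    listSum (λ u → seq (f u) n ℚ.- seq (average (map f xs)) n) xs ≡ 0ℚ
  listSum-deviation f n []          = refl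
  listSum-deviation f n xs@(x ∷ xs′) = begin
    listSum (λ u → seq (f u) n ℚ.- mean) xs           ≡⟨ listSum-minus (λ u → seq (f u) n) mean xs ⟩
    S ℚ.- mean ℚ.* fromℕℚ (length xs)                 ≡⟨ cong₂ (λ s l → S ℚ.- ((+ 1 / suc l) ℚ.* s) ℚ.* fromℕℚ (length xs))
                                                           (seq-foldr f n xs) (length-map f xs′) ⟩
    S ℚ.- (w ℚ.* S) ℚ.* fromℕℚ (length xs)            ≡⟨ lem S w (fromℕℚ (length xs)) ⟩
    S ℚ.- w ℚ.* fromℕℚ (length xs) ℚ.* S              ≡⟨ cong (λ v → S ℚ.- v ℚ.* S) (1/n*n (length xs)) ⟩
    S ℚ.- 1ℚ ℚ.* S                                    ≡⟨ lem′ S ⟩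
    0ℚ                                                ∎
    where
    open ≡-Reasoning
    mean S w : ℚ
    mean = seq (average (map f xs)) n
    S = listSum (λ u → seq (f u) n) xs
    w = + 1 / length xs
    lem : ∀ s w l → s ℚ.- (w ℚ.* s) ℚ.* l ≡ s ℚ.- w ℚ.* l ℚ.* s
    lem = solve 3 (λ s w l → s :- (w :* s) :* l := s :- w :* l :* s) refl
      where open +-*-Solver
    lem′ : ∀ s → s ℚ.- 1ℚ ℚ.* s ≡ 0ℚ
    lem′ = solve 1 (λ s → s :- con 1ℚ :* s := con 0ℚ) refl
      where open +-*-Solver

∣⇒≡0 : ∀ {m n} → n ℕ.< m → m ∣ n → n ≡ 0
∣⇒≡0 {n = zero}  n<m m∣n = refl
∣⇒≡0 {n = suc n} n<m m∣n = contradiction (ℕ.∣⇒≤ m∣n) (ℕ.<⇒≱ n<m)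

module _ {m : ℕ} where

  Congruent⇒≤ : ∀ {i j : Fin m} → Congruent m (+ toℕ i) (+ toℕ j) → toℕ i ℕ.≤ toℕ j
  Congruent⇒≤ {i} {j} (congruent m∣) with ℕ.≤-total (toℕ i) (toℕ j)
  ... | inj₁ i≤j = i≤j
  ... | inj₂ j≤i = ℕ.m∸n≡0⇒m≤n (∣⇒≡0 (ℕ.≤-<-trans (ℕ.m∸n≤m (toℕ i) (toℕ j)) (Fin.toℕ<n i))
    (subst (m ∣_) abs (ℤ∣.∣⇒∣ᵤ m∣)))
    where
    abs : ℤ.∣ + toℕ i ℤ.- + toℕ j ∣ ≡ toℕ i ℕ.∸ toℕ j
    abs = cong ℤ.∣_∣ (trans (ℤ.m-n≡m⊖n (toℕ i) (toℕ j)) (ℤ.⊖-≥ j≤i))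

  Congruent⇒≡ : ∀ {i j : Fin m} → Congruent m (+ toℕ i) (+ toℕ j) → i ≡ j
  Congruent⇒≡ cgr = Fin.toℕ-injective (ℕ.≤-antisym (Congruent⇒≤ cgr) (Congruent⇒≤ (Congruent-sym cgr)))

module _ (m : ℕ) .{{_ : NonZero m}} where

  residueOf : ℤ → ℤₘ m
  residueOf a = fromℕ< (n%ℕd<d a m)

  residueOf-Congruent : ∀ a → Congruent m a (+ toℕ (residueOf a))
  residueOf-Congruent a = congruent (divides (a /ℕ m) (begin
    a ℤ.- + toℕ (residueOf a)                          ≡⟨ cong (λ k → a ℤ.- + k) (Fin.toℕ-fromℕ< (n%ℕd<d a m)) ⟩
    a ℤ.- + (a %ℕ m)                                   ≡⟨ cong (ℤ._- + (a %ℕ m)) (a≡a%ℕn+[a/ℕn]*n a m) ⟩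
    + (a %ℕ m) ℤ.+ (a /ℕ m) ℤ.* + m ℤ.- + (a %ℕ m)     ≡⟨ lem (+ (a %ℕ m)) ((a /ℕ m) ℤ.* + m) ⟩
    (a /ℕ m) ℤ.* + m                                   ∎))
    where
    open ≡-Reasoning
    lem : ∀ r k → r ℤ.+ k ℤ.- r ≡ k
    lem = solve-∀

  residueOf-cong : ∀ {a b} → Congruent m a b → residueOf a ≡ residueOf b
  residueOf-cong {a} {b} cgr = Congruent⇒≡
    (Congruent-trans (Congruent-trans (Congruent-sym (residueOf-Congruent a)) cgr) (residueOf-Congruent b))

  residueOf-toℕ : ∀ i → residueOf (+ toℕ i) ≡ i
  residueOf-toℕ i = Congruent⇒≡ (Congruent-sym (residueOf-Congruent (+ toℕ i)))

  +ₘ-Congruent : ∀ i j → Congruent m (+ toℕ i ℤ.+ + toℕ j) (+ toℕ (i +ₘ j))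
  +ₘ-Congruent i j = residueOf-Congruent (+ (toℕ i ℕ.+ toℕ j))

  residueOf-sum : ∀ {a b c x} → Congruent m (a ℤ.+ b ℤ.+ c) (+ toℕ x) →
                  x ≡ residueOf a +ₘ residueOf b +ₘ residueOf c
  residueOf-sum {a} {b} {c} {x} cgr = Congruent⇒≡ (Congruent-trans (Congruent-sym cgr)
    (Congruent-trans (Congruent-+ a+b (residueOf-Congruent c)) (+ₘ-Congruent (residueOf a +ₘ residueOf b) (residueOf c))))
    where
    a+b : Congruent m (a ℤ.+ b) (+ toℕ (residueOf a +ₘ residueOf b))
    a+b = Congruent-trans (Congruent-+ (residueOf-Congruent a) (residueOf-Congruent b))
                          (+ₘ-Congruent (residueOf a) (residueOf b))

  extend : (ℤₘ* m → ℚ) → ℤ → ℚ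
  extend k a = maybe′ k 0ℚ (reducedResidue? m (residueOf a))

  extend-periodic : ∀ k → Periodic m (extend k)
  extend-periodic k a c = cong (λ i → maybe′ k 0ℚ (reducedResidue? m i))
    (residueOf-cong {a ℤ.+ c ℤ.* + m} {a} (congruent (divides c (lem a (c ℤ.* + m)))))
    where
    lem : ∀ a k → a ℤ.+ k ℤ.- a ≡ k
    lem = solve-∀

  ∣-residueOf : ∀ {p a} → p ∣ m → + p ∣ᶻ a → p ∣ toℕ (residueOf a)
  ∣-residueOf p∣m p∣a = ℤ∣.∣⇒∣ᵤ (Congruent-∣ (ℤ∣.∣ᵤ⇒∣ p∣m) (residueOf-Congruent _) p∣a)

  ∣-residueOf⁻¹ : ∀ {p a} → p ∣ m → p ∣ toℕ (residueOf a) → + p ∣ᶻ a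
  ∣-residueOf⁻¹ {p} p∣m p∣r = Congruent-∣ (ℤ∣.∣ᵤ⇒∣ p∣m) (Congruent-sym (residueOf-Congruent _)) (ℤ∣.∣ᵤ⇒∣ {+ p} p∣r)

  extend-vanishes : ∀ k {p a} → p ≢ 1 → p ∣ m → + p ∣ᶻ a → extend k a ≡ 0ℚ
  extend-vanishes k {p} {a} p≢1 p∣m p∣a with coprime? (toℕ (residueOf a)) m
  ... | yes r⊥m = contradiction (r⊥m (∣-residueOf p∣m p∣a , p∣m)) p≢1
  ... | no  _   = refl

  extend-unit : ∀ k {a} (a⊥m : Coprime (toℕ (residueOf a)) m) → extend k a ≡ k (unit (residueOf a) a⊥m)
  extend-unit k {a} a⊥m with coprime? (toℕ (residueOf a)) m
  ... | yes _ = refl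
  ... | no ¬⊥ = contradiction (λ {d} → a⊥m {d}) ¬⊥

  avoids⇒coprime : ∀ {ps} → product ps ≡ m → All Prime ps → ∀ {a} → Avoids ps a → Coprime (toℕ (residueOf a)) m
  avoids⇒coprime {ps} Πps≡m primes {a} avoids {d} (d∣r , d∣m) = go d d∣r d∣m (factorise d {{d≢0}})
    where
    d≢0 : NonZero d
    d≢0 = ℕ.≢-nonZero λ { refl → ℕ.≢-nonZero⁻¹ m (ℕ.0∣⇒≡0 d∣m) }
    go : ∀ d → d ∣ toℕ (residueOf a) → d ∣ m → PrimeFactorisation d → d ≡ 1
    go d d∣r d∣m record { factors = [] ; isFactorisation = d≡1 } = d≡1
    go d d∣r d∣m record { factors = p ∷ qs ; isFactorisation = d≡ ; factorsPrime = p-prime ∷ _ } =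
      contradiction (∣-residueOf⁻¹ p∣m (ℕ.∣-trans p∣d d∣r)) (All.lookup avoids
        (factorisationHasAllPrimeFactors p-prime (subst (p ∣_) (sym Πps≡m) p∣m) primes))
      where
      p∣d : p ∣ d
      p∣d = subst (p ∣_) (sym d≡) (ℕ.m∣m*n (product qs))
      p∣m : p ∣ m
      p∣m = ℕ.∣-trans p∣d d∣m

Congruent-% : ∀ {m} .{{_ : NonZero m}} {k l} → Congruent m (+ k) (+ l) → k % m ≡ l % m
Congruent-% {m} {k} {l} cgr = trans (sym (Fin.toℕ-fromℕ< (n%ℕd<d (+ k) m)))
  (trans (cong toℕ (residueOf-cong m cgr)) (Fin.toℕ-fromℕ< (n%ℕd<d (+ l) m)))

%-Congruent : ∀ {m} .{{_ : NonZero m}} k → Congruent m (+ k) (+ (k % m))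
%-Congruent {m} k = congruent (divides (+ (k ℕ./ m)) (begin
  + k ℤ.- + (k % m)                                        ≡⟨ cong (λ l → + l ℤ.- + (k % m)) (m≡m%n+[m/n]*n k m) ⟩
  + (k % m) ℤ.+ + ((k ℕ./ m) ℕ.* m) ℤ.- + (k % m)          ≡⟨ lem (+ (k % m)) (+ ((k ℕ./ m) ℕ.* m)) ⟩
  + ((k ℕ./ m) ℕ.* m)                                      ≡⟨ ℤ.pos-* (k ℕ./ m) m ⟩
  + (k ℕ./ m) ℤ.* + m                                      ∎))
  where
  open ≡-Reasoning
  lem : ∀ r s → r ℤ.+ s ℤ.- r ≡ s
  lem = solve-∀

data Class : ℕ → Set where
  one : Class 1
  two : Class 2

module ClassSum (m q : ℕ) .{{_ : NonZero m}} (3q≡m : 3 ℕ.* q ≡ m) where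

  3∣m : 3 ∣ m
  3∣m = subst (3 ∣_) 3q≡m (ℕ.m∣m*n q)

  restrict : ℕ → (ℤₘ* m → ℚ) → ℤₘ* m → ℚ
  restrict j k u = if does (toℕ (residue u) % 3 ℕ.≟ j) then k u else 0ℚ

  residueOf-%3 : ∀ {a b} → b ℕ.< 3 → Congruent 3 a (+ b) → toℕ (residueOf m a) % 3 ≡ b
  residueOf-%3 {a} b<3 cgr = trans
    (Congruent-% (Congruent-trans (Congruent-sym (Congruent-weaken 3∣m (residueOf-Congruent m a))) cgr))
    (m<n⇒m%n≡m b<3)

  extend-restrict-≡ : ∀ k a {j} → toℕ (residueOf m a) % 3 ≡ j → extend m (restrict j k) a ≡ extend m k a
  extend-restrict-≡ k a {j} a%3≡j with coprime? (toℕ (residueOf m a)) m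
  ... | yes a⊥m = cong (if_then k (unit (residueOf m a) a⊥m) else 0ℚ) (dec-true (toℕ (residueOf m a) % 3 ℕ.≟ j) a%3≡j)
  ... | no  _   = refl

  extend-restrict-≢ : ∀ k a {j} → toℕ (residueOf m a) % 3 ≢ j → extend m (restrict j k) a ≡ 0ℚ
  extend-restrict-≢ k a {j} a%3≢j with coprime? (toℕ (residueOf m a)) m
  ... | yes a⊥m = cong (if_then k (unit (residueOf m a) a⊥m) else 0ℚ) (dec-false (toℕ (residueOf m a) % 3 ℕ.≟ j) a%3≢j)
  ... | no  _   = refl

  Congruent-fibre : ∀ b d → Congruent 3 (+ b ℤ.+ + 3 ℤ.* d) (+ b)
  Congruent-fibre b d = congruent (divides d (lem (+ b) d))
    where
    lem : ∀ b d → b ℤ.+ + 3 ℤ.* d ℤ.- b ≡ d ℤ.* + 3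
    lem = solve-∀

  fibre-≡ : ∀ k {j} → j ℕ.< 3 → fibreSum 3 q (extend m (restrict j k)) (+ j) ≡ fibreSum 3 q (extend m k) (+ j)
  fibre-≡ k {j} j<3 = Σ-cong q λ d → extend-restrict-≡ k (+ j ℤ.+ + 3 ℤ.* d) (residueOf-%3 j<3 (Congruent-fibre j d))

  fibre-≢ : ∀ k {b j} → b ℕ.< 3 → b ≢ j → fibreSum 3 q (extend m (restrict j k)) (+ b) ≡ 0ℚ
  fibre-≢ k {b} b<3 b≢j = trans
    (Σ-cong q λ d → extend-restrict-≢ k (+ b ℤ.+ + 3 ℤ.* d) (b≢j ∘ trans (sym (residueOf-%3 b<3 (Congruent-fibre b d)))))
    (Sum.sum-replicate-zero q)

  listSum-fibres : ∀ k j → listSum k (reducedResidues≡ j mod3 m) ≡ Σ[ b < 3 ] fibreSum 3 q (extend m (restrict j k)) b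
  listSum-fibres k j = begin
    listSum k (reducedResidues≡ j mod3 m)
      ≡⟨ listSum-filter (λ a → toℕ (residue a) % 3 ℕ.≟ j) k (reducedResidues m) ⟩
    listSum (restrict j k) (reducedResidues m)
      ≡⟨ listSum-mapMaybe (reducedResidue? m) (restrict j k) (allFin m) ⟩
    listSum (λ y → maybe′ (restrict j k) 0ℚ (reducedResidue? m y)) (allFin m)
      ≡⟨ listSum-tabulate (λ y → maybe′ (restrict j k) 0ℚ (reducedResidue? m y)) (λ y → y) ⟩
    Sum.sum {m} (λ y → maybe′ (restrict j k) 0ℚ (reducedResidue? m y))
      ≡⟨ Sum.sum-cong-≗ {m} (λ y → cong (λ i → maybe′ (restrict j k) 0ℚ (reducedResidue? m i)) (sym (residueOf-toℕ m y))) ⟩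
    residueSum m (extend m (restrict j k))
      ≡⟨ cong (λ n → residueSum n (extend m (restrict j k))) (sym 3q≡m) ⟩
    residueSum (3 ℕ.* q) (extend m (restrict j k))
      ≡⟨ Σ-blocks 3 q (extend m (restrict j k)) ⟩
    Σ[ b < 3 ] fibreSum 3 q (extend m (restrict j k)) b ∎
    where open ≡-Reasoning

  listSum-class : ∀ k {j} → Class j → listSum k (reducedResidues≡ j mod3 m) ≡ fibreSum 3 q (extend m k) (+ j)
  listSum-class k one = begin
    listSum k (reducedResidues≡ 1 mod3 m)           ≡⟨ listSum-fibres k 1 ⟩
    R 0 ℚ.+ (R 1 ℚ.+ (R 2 ℚ.+ 0ℚ))                  ≡⟨ cong₂ (λ v w → v ℚ.+ (R 1 ℚ.+ (w ℚ.+ 0ℚ)))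
                                                         (fibre-≢ k {0} {1} (ℕ.s≤s ℕ.z≤n) λ ())
                                                         (fibre-≢ k {2} {1} (ℕ.s≤s (ℕ.s≤s (ℕ.s≤s ℕ.z≤n))) λ ()) ⟩
    0ℚ ℚ.+ (R 1 ℚ.+ 0ℚ)                             ≡⟨ trans (ℚ.+-identityˡ _) (ℚ.+-identityʳ _) ⟩
    R 1                                             ≡⟨ fibre-≡ k {1} (ℕ.s≤s (ℕ.s≤s ℕ.z≤n)) ⟩
    fibreSum 3 q (extend m k) (+ 1)                 ∎
    where
    open ≡-Reasoning
    R : ℕ → ℚ
    R b = fibreSum 3 q (extend m (restrict 1 k)) (+ b)
  listSum-class k two = begin
    listSum k (reducedResidues≡ 2 mod3 m)           ≡⟨ listSum-fibres k 2 ⟩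
    R 0 ℚ.+ (R 1 ℚ.+ (R 2 ℚ.+ 0ℚ))                  ≡⟨ cong₂ (λ v w → v ℚ.+ (w ℚ.+ (R 2 ℚ.+ 0ℚ)))
                                                         (fibre-≢ k {0} {2} (ℕ.s≤s ℕ.z≤n) λ ())
                                                         (fibre-≢ k {1} {2} (ℕ.s≤s (ℕ.s≤s ℕ.z≤n)) λ ()) ⟩
    0ℚ ℚ.+ (0ℚ ℚ.+ (R 2 ℚ.+ 0ℚ))                    ≡⟨ trans (ℚ.+-identityˡ _) (trans (ℚ.+-identityˡ _) (ℚ.+-identityʳ _)) ⟩
    R 2                                             ≡⟨ fibre-≡ k {2} (ℕ.s≤s (ℕ.s≤s (ℕ.s≤s ℕ.z≤n))) ⟩
    fibreSum 3 q (extend m k) (+ 2)                 ∎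
    where
    open ≡-Reasoning
    R : ℕ → ℚ
    R b = fibreSum 3 q (extend m (restrict 2 k)) (+ b)

prime≥5 : ∀ {p} → Prime p → p ≢ 2 → p ≢ 3 → 5 ℕ.≤ p
prime≥5 {0} p-prime _ _ = contradiction p-prime (from-no (prime? 0))
prime≥5 {1} p-prime _ _ = contradiction p-prime (from-no (prime? 1))
prime≥5 {2} _ 2≢2 _ = contradiction refl 2≢2
prime≥5 {3} _ _ 3≢3 = contradiction refl 3≢3
prime≥5 {4} p-prime _ _ = contradiction p-prime (from-no (prime? 4))
prime≥5 {suc (suc (suc (suc (suc _))))} _ _ _ = ℕ.s≤s (ℕ.s≤s (ℕ.s≤s (ℕ.s≤s (ℕ.s≤s ℕ.z≤n))))

Φ-positive : ∀ {ps} → All (5 ℕ.≤_) ps → ℚ.Positive (Φ ps)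
Φ-positive []                    = ℚ.positive (ℚ.positive⁻¹ 1ℚ)
Φ-positive {p ∷ ps} (5≤p ∷ 5≤ps) =
  ℚ.pos*pos⇒pos (φ p) {{ℚ.positive (0<φ p 5≤p)}} (Φ ps) {{Φ-positive 5≤ps}}
  where
  instance
    p-nonZero : NonZero p
    p-nonZero = ℕ.>-nonZero (ℕ.<-≤-trans ℕ.z<s 5≤p)

module Stage (m : ℕ) .{{_ : NonZero m}} (odd : ¬ 2 ∣ m) (sqf : Squarefree m) (q : ℕ) (3q≡m : 3 ℕ.* q ≡ m)
             (fact : PrimeFactorisation q) where
  open ClassSum m q 3q≡m
  open PrimeFactorisation fact renaming (factors to ps)

  3*Πps≡m : 3 ℕ.* product ps ≡ m
  3*Πps≡m = trans (cong (3 ℕ.*_) (sym isFactorisation)) 3q≡m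

  factor∣q : ∀ {p} → Any (p ≡_) ps → p ∣ q
  factor∣q p∈ps = subst (_ ∣_) (sym isFactorisation) (∈⇒∣product p∈ps)

  factor∣m : ∀ {p} → Any (p ≡_) ps → p ∣ m
  factor∣m p∈ps = subst (_ ∣_) 3q≡m (ℕ.∣n⇒∣m*n 3 (factor∣q p∈ps))

  factors≥5 : All (5 ℕ.≤_) ps
  factors≥5 = All.tabulate λ p∈ps → prime≥5 (All.lookup factorsPrime p∈ps)
    (λ { refl → odd (factor∣m p∈ps) })
    (λ { refl → contradiction (sqf 3 (subst (9 ∣_) 3q≡m (ℕ.*-monoʳ-∣ 3 (factor∣q p∈ps)))) λ () })

  vanishes : ∀ k → Vanishes ps (extend m k)
  vanishes k meets = go (λ p∈ps → p∈ps) meets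
    where
    go : ∀ {qs} → (∀ {p} → Any (p ≡_) qs → Any (p ≡_) ps) → ∀ {a} → Meets qs a → extend m k a ≡ 0ℚ
    go qs⊆ps (here p∣a)  = extend-vanishes m k
      (λ { refl → ℕ.<⇒≱ (ℕ.s≤s (ℕ.s≤s ℕ.z≤n)) (All.lookup factors≥5 (qs⊆ps (here refl))) })
      (factor∣m (qs⊆ps (here refl))) p∣a
    go qs⊆ps (there meets) = go (qs⊆ps ∘ there) meets

  3∤class : ∀ {j b} → Class j → Congruent 3 b (+ j) → ¬ + 3 ∣ᶻ b
  3∤class one b≡j 3∣b = contradiction (ℤ∣.∣⇒∣ᵤ (Congruent-∣ ℤ∣.∣-refl b≡j 3∣b)) (from-no (3 ∣? 1))
  3∤class two b≡j 3∣b = contradiction (ℤ∣.∣⇒∣ᵤ (Congruent-∣ ℤ∣.∣-refl b≡j 3∣b)) (from-no (3 ∣? 2))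

  coprime-m : ∀ {j b} → Class j → Congruent 3 b (+ j) → Avoids ps b → Coprime (toℕ (residueOf m b)) m
  coprime-m cls b≡j avoids = avoids⇒coprime m {3 ∷ ps} 3*Πps≡m (from-yes (prime? 3) ∷ factorsPrime)
    (3∤class cls b≡j ∷ avoids)

  module _ (f : ℤₘ* m → ℝ) (n : ℕ) where

    mean : ℕ → ℚ
    mean j = seq (average (map f (reducedResidues≡ j mod3 m))) n

    -- Subtracting the class average makes the fibre sums vanish, which avoids counting
    -- the units in a class.
    deviation : ℕ → ℤₘ* m → ℚ
    deviation j u = seq (f u) n ℚ.- mean j

    fibreSum-deviation : ∀ {j} → Class j → fibreSum 3 (product ps) (extend m (deviation j)) (+ j) ≡ 0ℚ
    fibreSum-deviation {j} cls = trans (cong (λ r → fibreSum 3 r (extend m (deviation j)) (+ j)) (sym isFactorisation))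
      (trans (sym (listSum-class (deviation j) cls)) (listSum-deviation f n (reducedResidues≡ j mod3 m)))

    exceeds-mean : ∀ {j₁ j₂ j₃} → Class j₁ → Class j₂ → Class j₃ →
      ∀ x → Congruent 3 (+ j₁ ℤ.+ + j₂ ℤ.+ + j₃) (+ toℕ x) →
      ∃[ u₁ ] ∃[ u₂ ] ∃[ u₃ ] (x ≡ residue u₁ +ₘ residue u₂ +ₘ residue u₃ ×
        mean j₁ ℚ.+ mean j₂ ℚ.+ mean j₃ ℚ.≤ seq (f u₁) n ℚ.+ seq (f u₂) n ℚ.+ seq (f u₃) n)
    exceeds-mean {j₁} {j₂} {j₃} cls₁ cls₂ cls₃ x ≡x =
      u₁ , u₂ , u₃ , residueOf-sum m {L.b₁} {L.b₂} {L.b₃} L.target , (begin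
        mean j₁ ℚ.+ mean j₂ ℚ.+ mean j₃
          ≡⟨ ℚ.+-identityʳ (mean j₁ ℚ.+ mean j₂ ℚ.+ mean j₃) ⟨
        mean j₁ ℚ.+ mean j₂ ℚ.+ mean j₃ ℚ.+ 0ℚ
          ≤⟨ ℚ.+-monoʳ-≤ (mean j₁ ℚ.+ mean j₂ ℚ.+ mean j₃) 0≤dev ⟩
        mean j₁ ℚ.+ mean j₂ ℚ.+ mean j₃ ℚ.+ (deviation j₁ u₁ ℚ.+ deviation j₂ u₂ ℚ.+ deviation j₃ u₃)
          ≡⟨ lem (mean j₁) (mean j₂) (mean j₃) (seq (f u₁) n) (seq (f u₂) n) (seq (f u₃) n) ⟩
        seq (f u₁) n ℚ.+ seq (f u₂) n ℚ.+ seq (f u₃) n ∎)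
      where
      open ℚ.≤-Reasoning
      lem : ∀ a b c r s t → a ℚ.+ b ℚ.+ c ℚ.+ ((r ℚ.- a) ℚ.+ (s ℚ.- b) ℚ.+ (t ℚ.- c)) ≡ r ℚ.+ s ℚ.+ t
      lem = solve 6 (λ a b c r s t → a :+ b :+ c :+ ((r :- a) :+ (s :- b) :+ (t :- c)) := r :+ s :+ t) refl
        where open +-*-Solver
      g₁ g₂ g₃ : ℤ → ℚ
      g₁ = extend m (deviation j₁)
      g₂ = extend m (deviation j₂)
      g₃ = extend m (deviation j₃)
      module L = Lifted (lift ps {3} {m} 3*Πps≡m sqf factors≥5 {g₁} {g₂} {g₃}
        (extend-periodic m (deviation j₁)) (extend-periodic m (deviation j₂)) (extend-periodic m (deviation j₃))
        (vanishes (deviation j₁)) (vanishes (deviation j₂)) (vanishes (deviation j₃))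
        (+ j₁) (+ j₂) (+ j₃) (+ toℕ x) ≡x)
      ⊥₁ : Coprime (toℕ (residueOf m L.b₁)) m
      ⊥₁ = coprime-m cls₁ L.over₁ L.avoids₁
      ⊥₂ : Coprime (toℕ (residueOf m L.b₂)) m
      ⊥₂ = coprime-m cls₂ L.over₂ L.avoids₂
      ⊥₃ : Coprime (toℕ (residueOf m L.b₃)) m
      ⊥₃ = coprime-m cls₃ L.over₃ L.avoids₃
      u₁ u₂ u₃ : ℤₘ* m
      u₁ = unit (residueOf m L.b₁) ⊥₁
      u₂ = unit (residueOf m L.b₂) ⊥₂
      u₃ = unit (residueOf m L.b₃) ⊥₃
      0≤dev : 0ℚ ℚ.≤ deviation j₁ u₁ ℚ.+ deviation j₂ u₂ ℚ.+ deviation j₃ u₃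
      0≤dev = ℚ.*-cancelˡ-≤-pos (Φ ps) {{Φ-positive factors≥5}} (begin
        Φ ps ℚ.* 0ℚ
          ≡⟨ ℚ.*-zeroʳ (Φ ps) ⟩
        0ℚ ℚ.+ 0ℚ ℚ.+ 0ℚ
          ≡⟨ cong₂ ℚ._+_ (cong₂ ℚ._+_ (fibreSum-deviation cls₁) (fibreSum-deviation cls₂)) (fibreSum-deviation cls₃) ⟨
        fibreSum 3 (product ps) g₁ (+ j₁) ℚ.+ fibreSum 3 (product ps) g₂ (+ j₂) ℚ.+ fibreSum 3 (product ps) g₃ (+ j₃)
          ≤⟨ L.average≤ ⟩
        Φ ps ℚ.* (g₁ L.b₁ ℚ.+ g₂ L.b₂ ℚ.+ g₃ L.b₃)
          ≡⟨ cong (Φ ps ℚ.*_) (cong₂ ℚ._+_ (cong₂ ℚ._+_ (extend-unit m (deviation j₁) {L.b₁} ⊥₁)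
               (extend-unit m (deviation j₂) {L.b₂} ⊥₂)) (extend-unit m (deviation j₃) {L.b₃} ⊥₃)) ⟩
        Φ ps ℚ.* (deviation j₁ u₁ ℚ.+ deviation j₂ u₂ ℚ.+ deviation j₃ u₃) ∎)

-- Passage to the limit

bound-all : ∀ {m} {Q : Fin m → ℕ → Set} → (∀ i {M N} → M ℕ.≤ N → Q i M → Q i N) →
            (∀ i → ∃[ N ] Q i N) → ∃[ N ] (∀ i → Q i N)
bound-all {zero}  up each = 0 , λ ()
bound-all {suc m} up each with each Fin.zero | bound-all (λ i → up (Fin.suc i)) (each ∘ Fin.suc)
... | M , q₀ | N , qₛ = M ℕ.⊔ N , λ
  { Fin.zero    → up Fin.zero (ℕ.m≤m⊔n M N) q₀
  ; (Fin.suc i) → up (Fin.suc i) (ℕ.m≤n⊔m M N) (qₛ i)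
  }

module _ {m : ℕ} (f : ℤₘ* m → ℝ) where

  CloseFrom : ℚ → ℕ → ℤₘ* m → Set
  CloseFrom δ N u = ∀ k l → N ℕ.≤ k → N ℕ.≤ l → ℚ.∣ seq (f u) k ℚ.- seq (f u) l ∣ ℚ.< δ

  uniformly-cauchy : ∀ δ → 0ℚ ℚ.< δ → ∃[ N ] (∀ u → CloseFrom δ N u)
  uniformly-cauchy δ 0<δ with bound-all {m} {λ i N → .(i⊥m : Coprime (toℕ i) m) → CloseFrom δ N (unit i i⊥m)}
    (λ i M≤N close i⊥m k l N≤k N≤l → close i⊥m k l (ℕ.≤-trans M≤N N≤k) (ℕ.≤-trans M≤N N≤l)) each
    where
    each : ∀ i → ∃[ N ] (.(i⊥m : Coprime (toℕ i) m) → CloseFrom δ N (unit i i⊥m))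
    each i with coprime? (toℕ i) m
    ... | yes i⊥m = cauchy (f (unit i i⊥m)) δ 0<δ .proj₁ , λ _ → cauchy (f (unit i i⊥m)) δ 0<δ .proj₂
    ... | no ¬i⊥m = 0 , λ i⊥m → ⊥-elim-irr (¬i⊥m i⊥m)
  ... | N , close = N , λ { (unit i i⊥m) → close i i⊥m }

  sum-exceeds : ∀ {c ε n u₁ u₂ u₃} → 0ℚ ℚ.< ½ ℚ.* (½ ℚ.* ε) →
    (∀ u → CloseFrom (½ ℚ.* (½ ℚ.* ε)) n u) →
    c ℚ.+ ε ℚ.≤ seq (f u₁) n ℚ.+ seq (f u₂) n ℚ.+ seq (f u₃) n →
    fromℚ c <ℝ f u₁ +ℝ f u₂ +ℝ f u₃
  sum-exceeds {c} {ε} {n} {u₁} {u₂} {u₃} 0<δ close c+ε≤ = δ , 0<δ , n , λ k n≤k → begin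
    c ℚ.+ δ
      ≡⟨ quarters c ε ⟩
    c ℚ.+ ε ℚ.+ (ℚ.- δ ℚ.+ ℚ.- δ ℚ.+ ℚ.- δ)
      ≤⟨ ℚ.+-monoˡ-≤ (ℚ.- δ ℚ.+ ℚ.- δ ℚ.+ ℚ.- δ) c+ε≤ ⟩
    seq (f u₁) n ℚ.+ seq (f u₂) n ℚ.+ seq (f u₃) n ℚ.+ (ℚ.- δ ℚ.+ ℚ.- δ ℚ.+ ℚ.- δ)
      ≡⟨ regroup (seq (f u₁) n) (seq (f u₂) n) (seq (f u₃) n) δ ⟩
    (seq (f u₁) n ℚ.- δ) ℚ.+ (seq (f u₂) n ℚ.- δ) ℚ.+ (seq (f u₃) n ℚ.- δ)
      ≤⟨ ℚ.+-mono-≤ (ℚ.+-mono-≤ (below u₁ n≤k) (below u₂ n≤k)) (below u₃ n≤k) ⟩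
    seq (f u₁) k ℚ.+ seq (f u₂) k ℚ.+ seq (f u₃) k ∎
    where
    open ℚ.≤-Reasoning
    δ : ℚ
    δ = ½ ℚ.* (½ ℚ.* ε)
    quarters : ∀ c e → c ℚ.+ ½ ℚ.* (½ ℚ.* e) ≡
      c ℚ.+ e ℚ.+ (ℚ.- (½ ℚ.* (½ ℚ.* e)) ℚ.+ ℚ.- (½ ℚ.* (½ ℚ.* e)) ℚ.+ ℚ.- (½ ℚ.* (½ ℚ.* e)))
    quarters = solve 2 (λ c e → let d = con ½ :* (con ½ :* e) in
      c :+ d := c :+ e :+ (:- d :+ :- d :+ :- d)) refl
      where open +-*-Solver
    regroup : ∀ r s t d → r ℚ.+ s ℚ.+ t ℚ.+ (ℚ.- d ℚ.+ ℚ.- d ℚ.+ ℚ.- d) ≡ (r ℚ.- d) ℚ.+ (s ℚ.- d) ℚ.+ (t ℚ.- d)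
    regroup = solve 4 (λ r s t d → r :+ s :+ t :+ (:- d :+ :- d :+ :- d) := (r :- d) :+ (s :- d) :+ (t :- d)) refl
      where open +-*-Solver
    cancel : ∀ s t d → s ℚ.- d ≡ s ℚ.- t ℚ.+ (t ℚ.- d)
    cancel = solve 3 (λ s t d → s :- d := s :- t :+ (t :- d)) refl
      where open +-*-Solver
    cancel′ : ∀ t d → d ℚ.+ (t ℚ.- d) ≡ t
    cancel′ = solve 2 (λ t d → d :+ (t :- d) := t) refl
      where open +-*-Solver
    below : ∀ u {k} → n ℕ.≤ k → seq (f u) n ℚ.- δ ℚ.≤ seq (f u) k
    below u {k} n≤k = begin
      seq (f u) n ℚ.- δ
        ≡⟨ cancel (seq (f u) n) (seq (f u) k) δ ⟩
      seq (f u) n ℚ.- seq (f u) k ℚ.+ (seq (f u) k ℚ.- δ)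
        ≤⟨ ℚ.+-monoˡ-≤ (seq (f u) k ℚ.- δ)
             (ℚ.≤-trans (p≤∣p∣ (seq (f u) n ℚ.- seq (f u) k)) (ℚ.<⇒≤ (close u n k ℕ.≤-refl n≤k))) ⟩
      δ ℚ.+ (seq (f u) k ℚ.- δ)
        ≡⟨ cancel′ (seq (f u) k) δ ⟩
      seq (f u) k ∎
      where
      p≤∣p∣ : ∀ p → p ℚ.≤ ℚ.∣ p ∣
      p≤∣p∣ p with ℚ.≤-total 0ℚ p
      ... | inj₁ 0≤p = ℚ.≤-reflexive (sym (ℚ.0≤p⇒∣p∣≡p 0≤p))
      ... | inj₂ p≤0 = ℚ.≤-trans p≤0 (ℚ.0≤∣p∣ p)



choose-classes : ∀ {c} {mean : ℕ → ℚ} →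
  c ℚ.≤ (+ 2 / 1) ℚ.* mean 1 ℚ.+ mean 2 → c ℚ.≤ (+ 2 / 1) ℚ.* mean 2 ℚ.+ mean 1 → ∀ x →
  ∃[ j₁ ] ∃[ j₂ ] ∃[ j₃ ] (Class j₁ × Class j₂ × Class j₃ × Congruent 3 (+ j₁ ℤ.+ + j₂ ℤ.+ + j₃) (+ x) ×
    c ℚ.≤ mean j₁ ℚ.+ mean j₂ ℚ.+ mean j₃)
choose-classes {c} {mean} c≤₁ c≤₂ x = go (x % 3) (m%n<n x 3) (%-Congruent {3} x)
  where
  open ℚ.≤-Reasoning
  double : ∀ a b → (+ 2 / 1) ℚ.* a ℚ.+ b ≡ a ℚ.+ a ℚ.+ b
  double = solve 2 (λ a b → con (+ 2 / 1) :* a :+ b := a :+ a :+ b) refl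
    where open +-*-Solver
  c≤₁′ : c ℚ.≤ mean 1 ℚ.+ mean 1 ℚ.+ mean 2
  c≤₁′ = ℚ.≤-trans c≤₁ (ℚ.≤-reflexive (double (mean 1) (mean 2)))
  c≤₂′ : c ℚ.≤ mean 2 ℚ.+ mean 2 ℚ.+ mean 1
  c≤₂′ = ℚ.≤-trans c≤₂ (ℚ.≤-reflexive (double (mean 2) (mean 1)))
  go : ∀ r → r ℕ.< 3 → Congruent 3 (+ x) (+ r) →
    ∃[ j₁ ] ∃[ j₂ ] ∃[ j₃ ] (Class j₁ × Class j₂ × Class j₃ × Congruent 3 (+ j₁ ℤ.+ + j₂ ℤ.+ + j₃) (+ x) ×
      c ℚ.≤ mean j₁ ℚ.+ mean j₂ ℚ.+ mean j₃)
  go 0 _ x≡0 with ℚ.≤-total (mean 1) (mean 2)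
  ... | inj₁ m₁≤m₂ = 2 , 2 , 2 , two , two , two ,
    Congruent-trans (congruent (divides (+ 2) refl)) (Congruent-sym x≡0) ,
    ℚ.≤-trans c≤₂′ (ℚ.+-monoʳ-≤ (mean 2 ℚ.+ mean 2) m₁≤m₂)
  ... | inj₂ m₂≤m₁ = 1 , 1 , 1 , one , one , one ,
    Congruent-trans (congruent (divides (+ 1) refl)) (Congruent-sym x≡0) ,
    ℚ.≤-trans c≤₁′ (ℚ.+-monoʳ-≤ (mean 1 ℚ.+ mean 1) m₂≤m₁)
  go 1 _ x≡1 = 1 , 1 , 2 , one , one , two ,
    Congruent-trans (congruent (divides (+ 1) refl)) (Congruent-sym x≡1) , c≤₁′
  go 2 _ x≡2 = 2 , 2 , 1 , two , two , one ,
    Congruent-trans (congruent (divides (+ 1) refl)) (Congruent-sym x≡2) , c≤₂′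
  go (suc (suc (suc _))) (ℕ.s≤s (ℕ.s≤s (ℕ.s≤s ()))) _

proposition1p6 :
  (m : ℕ) .{{_ : NonZero m}} →
  ¬ (2 ∣ m) → Squarefree m → 3 ∣ m →
  (f : ℤₘ* m → ℝ) →
  (∀ a → fromℚ 0ℚ <ℝ f a × f a ≤ℝ fromℚ 1ℚ) →
  let α  = average (map f (reducedResidues m))
      α₁ = average (map f (reducedResidues≡ 1 mod3 m))
      α₂ = average (map f (reducedResidues≡ 2 mod3 m))
  in
  fromℚ (+ 3 / 2) <ℝ (+ 2 / 1) ·ℝ α₁ +ℝ α₂ →
  fromℚ (+ 3 / 2) <ℝ (+ 2 / 1) ·ℝ α₂ +ℝ α₁ →
  (x : ℤₘ m) →
  ∃[ a₁ ] ∃[ a₂ ] ∃[ a₃ ]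
    (x ≡ residue a₁ +ₘ residue a₂ +ₘ residue a₃ ×
     fromℚ (+ 3 / 2) <ℝ f a₁ +ℝ f a₂ +ℝ f a₃)
proposition1p6 m odd sqf (ℕ.divides q m≡q3) f _ (ε₁ , 0<ε₁ , N₁ , above₁) (ε₂ , 0<ε₂ , N₂ , above₂) x =
  let j₁ , j₂ , j₃ , cls₁ , cls₂ , cls₃ , ≡x , c≤ = choose-classes {+ 3 / 2 ℚ.+ ε} {mean f n}
        (ℚ.≤-trans (ℚ.+-monoʳ-≤ (+ 3 / 2) (ℚ.p⊓q≤p ε₁ ε₂)) (above₁ n N₁≤n))
        (ℚ.≤-trans (ℚ.+-monoʳ-≤ (+ 3 / 2) (ℚ.p⊓q≤q ε₁ ε₂)) (above₂ n N₂≤n)) (toℕ x)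
      u₁ , u₂ , u₃ , x≡ , means≤ = exceeds-mean f n cls₁ cls₂ cls₃ x ≡x
  in u₁ , u₂ , u₃ , x≡ , sum-exceeds f {+ 3 / 2} {ε} {u₁ = u₁} {u₂} {u₃} 0<δ
       (λ u k l n≤k n≤l → close u k l (ℕ.≤-trans N≤n n≤k) (ℕ.≤-trans N≤n n≤l)) (ℚ.≤-trans c≤ means≤)
  where
  3q≡m : 3 ℕ.* q ≡ m
  3q≡m = trans (ℕ.*-comm 3 q) (sym m≡q3)
  q-nonZero : NonZero q
  q-nonZero = ℕ.≢-nonZero λ { refl → ℕ.≢-nonZero⁻¹ m m≡q3 }
  open Stage m odd sqf q 3q≡m (factorise q {{q-nonZero}})
  ε δ : ℚ
  ε = ε₁ ℚ.⊓ ε₂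
  δ = ½ ℚ.* (½ ℚ.* ε)
  0<ε : 0ℚ ℚ.< ε
  0<ε with ℚ.⊓-sel ε₁ ε₂
  ... | inj₁ eq = subst (0ℚ ℚ.<_) (sym eq) 0<ε₁
  ... | inj₂ eq = subst (0ℚ ℚ.<_) (sym eq) 0<ε₂
  half-positive : ∀ {e} → 0ℚ ℚ.< e → 0ℚ ℚ.< ½ ℚ.* e
  half-positive {e} 0<e = subst (ℚ._< ½ ℚ.* e) (ℚ.*-zeroʳ ½) (ℚ.*-monoʳ-<-pos ½ 0<e)
  0<δ : 0ℚ ℚ.< δ
  0<δ = half-positive (half-positive 0<ε)
  N n : ℕ
  N = uniformly-cauchy f δ 0<δ .proj₁
  n = N₁ ℕ.⊔ N₂ ℕ.⊔ N
  close : ∀ u → CloseFrom f δ N u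
  close = uniformly-cauchy f δ 0<δ .proj₂
  N₁≤n : N₁ ℕ.≤ n
  N₁≤n = ℕ.≤-trans (ℕ.m≤m⊔n N₁ N₂) (ℕ.m≤m⊔n (N₁ ℕ.⊔ N₂) N)
  N₂≤n : N₂ ℕ.≤ n
  N₂≤n = ℕ.≤-trans (ℕ.m≤n⊔m N₁ N₂) (ℕ.m≤m⊔n (N₁ ℕ.⊔ N₂) N)
  N≤n : N ℕ.≤ n
  N≤n = ℕ.m≤n⊔m (N₁ ℕ.⊔ N₂) N
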